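{- Let $n,k$ be positive integers and let $\mathscr{A}_n^k(x)=\sum_{w\in\{0,1,\dots,k-1\}^n}x^{asc(w)}$ be the $n$-th ascent polynomial for $k$-ary words, and let $(a,b)$ be its $\mathcal{I}_n$-decomposition. If $k>n$, then $\mathcal{I}_n(\mathscr{A}_n^k)\ll\mathscr{A}_n^k$ for $\deg(\mathscr{A}_n^k(x))=n$. In particular, $\mathscr{A}_n^k(x)$ is alternatingly increasing and $b\ll a$.
   Context: For a word $w=w_1\cdots w_n$ put $w_0=0$; $asc(w)$ is the number of $i\in\{0,1,\dots,n-1\}$ with $w_i<w_{i+1}$. For $p$ of degree at most $n$, $\mathcal{I}_n(p)(x)=x^np(1/x)$. The $\mathcal{I}_n$-decomposition of $p$ is the unique pair $(a,b)$ with $p=a+xb$, $\mathcal{I}_n(a)=a$ and $\mathcal{I}_{n-1}(b)=b$. For real-rooted real polynomials $f,g$ with zeros $\{r_i\}$, $\{s_j\}$ in decreasing order, $g\preceq f$ means either $\deg f=\deg g+1=d$ and $r_d\le s_{d-1}\le\cdots\le s_1\le r_1$, or $\deg f=\deg g=d$ and $s_d\le r_d\le\cdots\le s_1\le r_1$; $g\ll f$ means $g\preceq f$ with leading coefficients of the same sign, or $f\preceq g$ with leading coefficients of opposite sign; by convention $0\ll f$ and $f\ll0$ for real-rooted $f$. A polynomial $p=\sum_{j=0}^np_jx^j$ of degree $n$ is alternatingly increasing if $0\le p_0\le p_n\le p_1\le p_{n-1}\le\cdots\le p_{\lfloor(n+1)/2\rfloor}$. -}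

module Defs where

open import Data.Fin.Base using (Fin; toℕ; inject₁)
open import Data.List.Base as List
  using (List; []; _∷_; _++_; length; foldr; filter; replicate; upTo; allFin;
         cartesianProductWith)
open import Data.List.Relation.Unary.Linked using (Linked)
open import Data.Nat.Base as ℕ using (ℕ; zero; suc; _∸_)
import Data.Nat.Properties as ℕP
open import Data.Product.Base using (Σ; _×_; _,_)
open import Data.Rational.Base as ℚ using (ℚ; 0ℚ; 1ℚ; ½; 1/_; ∣_∣)
import Data.Rational.Properties as ℚP
open import Data.Rational.Solver using (module +-*-Solver)
open import Data.Sum.Base using (_⊎_)
open import Data.Vec.Base as Vec using (Vec; lookup)
open import Relation.Binary.PropositionalEquality
  using (_≡_; refl; sym; trans; cong; subst)

------------------------------------------------------------------------
-- Real numbers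

-- Reals are rational Cauchy sequences equipped with a modulus of
-- convergence, considered up to _≈_.

record ℝ : Set where
  field
    seq    : ℕ → ℚ
    cauchy : ∀ ε → 0ℚ ℚ.< ε →
             Σ ℕ λ N → ∀ m n → N ℕ.≤ m → N ℕ.≤ n →
               ∣ seq m ℚ.- seq n ∣ ℚ.≤ ε

open ℝ public

infix  4 _≈_ _≤_ _≥_ _<_ _#_
infixl 6 _+ᴿ_
infixl 7 _*ᴿ_
infix  8 -ᴿ_

_≈_ : ℝ → ℝ → Set
x ≈ y = ∀ ε → 0ℚ ℚ.< ε →
        Σ ℕ λ N → ∀ n → N ℕ.≤ n → ∣ seq x n ℚ.- seq y n ∣ ℚ.≤ ε

_≤_ : ℝ → ℝ → Set
x ≤ y = ∀ ε → 0ℚ ℚ.< ε →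
        Σ ℕ λ N → ∀ n → N ℕ.≤ n → seq x n ℚ.≤ seq y n ℚ.+ ε

_≥_ : ℝ → ℝ → Set
x ≥ y = y ≤ x

_<_ : ℝ → ℝ → Set
x < y = Σ ℚ λ ε → 0ℚ ℚ.< ε ×
        Σ ℕ λ N → ∀ n → N ℕ.≤ n → seq x n ℚ.+ ε ℚ.≤ seq y n

-- Apartness, the constructive form of x ≠ y.
_#_ : ℝ → ℝ → Set
x # y = x < y ⊎ y < x

fromℚ : ℚ → ℝ
fromℚ q .seq _ = q
fromℚ q .cauchy ε 0<ε = 0 , λ _ _ _ _ →
  subst (ℚ._≤ ε) (sym (cong ∣_∣ (ℚP.+-inverseʳ q))) (ℚP.<⇒≤ 0<ε)

0ᴿ 1ᴿ : ℝ
0ᴿ = fromℚ 0ℚ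
1ᴿ = fromℚ 1ℚ

private
  half-pos : ∀ {ε} → 0ℚ ℚ.< ε → 0ℚ ℚ.< ½ ℚ.* ε
  half-pos {ε} 0<ε =
    ℚP.positive⁻¹ _ {{ℚP.pos*pos⇒pos ½ ε {{ℚ.positive 0<ε}}}}

  halves : ∀ ε → ½ ℚ.* ε ℚ.+ ½ ℚ.* ε ≡ ε
  halves ε = trans (sym (ℚP.*-distribʳ-+ ε ½ ½)) (ℚP.*-identityˡ ε)

  ≤-⊔ˡ : ∀ {a b c} → a ℕ.⊔ b ℕ.≤ c → a ℕ.≤ c
  ≤-⊔ˡ {a} {b} = ℕP.≤-trans (ℕP.m≤m⊔n a b)

  ≤-⊔ʳ : ∀ {a b c} → a ℕ.⊔ b ℕ.≤ c → b ℕ.≤ c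
  ≤-⊔ʳ {a} {b} = ℕP.≤-trans (ℕP.m≤n⊔m a b)

  open +-*-Solver using (solve; _:=_; _:+_; _:*_; _:-_; :-_)

  +-diff : ∀ a b c d → (a ℚ.+ b) ℚ.- (c ℚ.+ d) ≡ (a ℚ.- c) ℚ.+ (b ℚ.- d)
  +-diff = solve 4 (λ a b c d →
    (a :+ b) :- (c :+ d) := (a :- c) :+ (b :- d)) refl

  neg-diff : ∀ a b → (ℚ.- a) ℚ.- (ℚ.- b) ≡ ℚ.- (a ℚ.- b)
  neg-diff = solve 2 (λ a b → (:- a) :- (:- b) := :- (a :- b)) refl

  *-diff : ∀ a b c d →
           a ℚ.* b ℚ.- c ℚ.* d ≡ a ℚ.* (b ℚ.- d) ℚ.+ (a ℚ.- c) ℚ.* d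
  *-diff = solve 4 (λ a b c d →
    a :* b :- c :* d := a :* (b :- d) :+ (a :- c) :* d) refl

  split-off : ∀ a b → a ≡ (a ℚ.- b) ℚ.+ b
  split-off = solve 2 (λ a b → a := (a :- b) :+ b) refl

  bounded : ∀ x → Σ ℚ λ B → 0ℚ ℚ.< B ×
            Σ ℕ λ N → ∀ n → N ℕ.≤ n → ∣ seq x n ∣ ℚ.≤ B
  bounded x with cauchy x 1ℚ (ℚP.positive⁻¹ 1ℚ)
  ... | N , close =
    1ℚ ℚ.+ ∣ seq x N ∣ ,
    ℚP.+-mono-<-≤ (ℚP.positive⁻¹ 1ℚ) (ℚP.0≤∣p∣ (seq x N)) ,
    N , λ n N≤n → begin
      ∣ seq x n ∣                              ≡⟨ cong ∣_∣ (split-off (seq x n) (seq x N)) ⟩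
      ∣ (seq x n ℚ.- seq x N) ℚ.+ seq x N ∣    ≤⟨ ℚP.∣p+q∣≤∣p∣+∣q∣ (seq x n ℚ.- seq x N) (seq x N) ⟩
      ∣ seq x n ℚ.- seq x N ∣ ℚ.+ ∣ seq x N ∣  ≤⟨ ℚP.+-monoˡ-≤ ∣ seq x N ∣ (close n N N≤n ℕP.≤-refl) ⟩
      1ℚ ℚ.+ ∣ seq x N ∣                       ∎
    where open ℚP.≤-Reasoning

  ∣*∣-mono : ∀ p q {P Q} → 0ℚ ℚ.< P → ∣ p ∣ ℚ.≤ P → ∣ q ∣ ℚ.≤ Q →
             ∣ p ℚ.* q ∣ ℚ.≤ P ℚ.* Q
  ∣*∣-mono p q {P} {Q} 0<P p≤P q≤Q = begin
    ∣ p ℚ.* q ∣      ≡⟨ ℚP.∣p*q∣≡∣p∣*∣q∣ p q ⟩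
    ∣ p ∣ ℚ.* ∣ q ∣  ≤⟨ ℚP.*-monoʳ-≤-nonNeg ∣ q ∣ {{ℚ.nonNegative (ℚP.0≤∣p∣ q)}} p≤P ⟩
    P ℚ.* ∣ q ∣      ≤⟨ ℚP.*-monoˡ-≤-nonNeg P {{ℚ.nonNegative (ℚP.<⇒≤ 0<P)}} q≤Q ⟩
    P ℚ.* Q          ∎
    where open ℚP.≤-Reasoning

  scale-down : ∀ K → 0ℚ ℚ.< K → ∀ ε → 0ℚ ℚ.< ε →
               Σ ℚ λ δ → 0ℚ ℚ.< δ × K ℚ.* δ ≡ ε
  scale-down K 0<K ε 0<ε = δ , 0<δ , Kδ≡ε
    where
    instance
      K-pos = ℚ.positive 0<K
      K-nonZero = ℚP.pos⇒nonZero K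
    δ = 1/ K ℚ.* ε
    0<δ : 0ℚ ℚ.< δ
    0<δ = ℚP.positive⁻¹ δ
            {{ℚP.pos*pos⇒pos (1/ K) {{ℚP.1/pos⇒pos K}} ε {{ℚ.positive 0<ε}}}}
    Kδ≡ε : K ℚ.* δ ≡ ε
    Kδ≡ε = trans (sym (ℚP.*-assoc K (1/ K) ε))
             (trans (cong (ℚ._* ε) (ℚP.*-inverseʳ K)) (ℚP.*-identityˡ ε))

  ∣*-*∣≤ : ∀ a b c d {B C δ} → 0ℚ ℚ.< B → 0ℚ ℚ.< δ →
           ∣ a ∣ ℚ.≤ B → ∣ d ∣ ℚ.≤ C →
           ∣ a ℚ.- c ∣ ℚ.≤ δ → ∣ b ℚ.- d ∣ ℚ.≤ δ →
           ∣ a ℚ.* b ℚ.- c ℚ.* d ∣ ℚ.≤ (B ℚ.+ C) ℚ.* δ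
  ∣*-*∣≤ a b c d {B} {C} {δ} 0<B 0<δ a≤B d≤C a-c≤δ b-d≤δ = begin
    ∣ a ℚ.* b ℚ.- c ℚ.* d ∣
      ≡⟨ cong ∣_∣ (*-diff a b c d) ⟩
    ∣ a ℚ.* (b ℚ.- d) ℚ.+ (a ℚ.- c) ℚ.* d ∣
      ≤⟨ ℚP.∣p+q∣≤∣p∣+∣q∣ (a ℚ.* (b ℚ.- d)) ((a ℚ.- c) ℚ.* d) ⟩
    ∣ a ℚ.* (b ℚ.- d) ∣ ℚ.+ ∣ (a ℚ.- c) ℚ.* d ∣
      ≤⟨ ℚP.+-mono-≤ (∣*∣-mono a (b ℚ.- d) 0<B a≤B b-d≤δ)
                     (∣*∣-mono (a ℚ.- c) d 0<δ a-c≤δ d≤C) ⟩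
    B ℚ.* δ ℚ.+ δ ℚ.* C
      ≡⟨ cong (λ t → B ℚ.* δ ℚ.+ t) (ℚP.*-comm δ C) ⟩
    B ℚ.* δ ℚ.+ C ℚ.* δ
      ≡⟨ ℚP.*-distribʳ-+ δ B C ⟨
    (B ℚ.+ C) ℚ.* δ ∎
    where open ℚP.≤-Reasoning

_+ᴿ_ : ℝ → ℝ → ℝ
(x +ᴿ y) .seq n = seq x n ℚ.+ seq y n
(x +ᴿ y) .cauchy ε 0<ε
  with cauchy x (½ ℚ.* ε) (half-pos 0<ε) | cauchy y (½ ℚ.* ε) (half-pos 0<ε)
... | M , closeˣ | N , closeʸ = M ℕ.⊔ N , λ m n m≥ n≥ → begin
  ∣ (seq x m ℚ.+ seq y m) ℚ.- (seq x n ℚ.+ seq y n) ∣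
    ≡⟨ cong ∣_∣ (+-diff (seq x m) (seq y m) (seq x n) (seq y n)) ⟩
  ∣ (seq x m ℚ.- seq x n) ℚ.+ (seq y m ℚ.- seq y n) ∣
    ≤⟨ ℚP.∣p+q∣≤∣p∣+∣q∣ (seq x m ℚ.- seq x n) (seq y m ℚ.- seq y n) ⟩
  ∣ seq x m ℚ.- seq x n ∣ ℚ.+ ∣ seq y m ℚ.- seq y n ∣
    ≤⟨ ℚP.+-mono-≤ (closeˣ m n (≤-⊔ˡ m≥) (≤-⊔ˡ n≥))
                   (closeʸ m n (≤-⊔ʳ {M} m≥) (≤-⊔ʳ {M} n≥)) ⟩
  ½ ℚ.* ε ℚ.+ ½ ℚ.* ε
    ≡⟨ halves ε ⟩
  ε ∎
  where open ℚP.≤-Reasoning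

-ᴿ_ : ℝ → ℝ
(-ᴿ x) .seq n = ℚ.- seq x n
(-ᴿ x) .cauchy ε 0<ε with cauchy x ε 0<ε
... | N , close = N , λ m n m≥ n≥ → begin
  ∣ (ℚ.- seq x m) ℚ.- (ℚ.- seq x n) ∣  ≡⟨ cong ∣_∣ (neg-diff (seq x m) (seq x n)) ⟩
  ∣ ℚ.- (seq x m ℚ.- seq x n) ∣        ≡⟨ ℚP.∣-p∣≡∣p∣ (seq x m ℚ.- seq x n) ⟩
  ∣ seq x m ℚ.- seq x n ∣              ≤⟨ close m n m≥ n≥ ⟩
  ε                                    ∎
  where open ℚP.≤-Reasoning

_*ᴿ_ : ℝ → ℝ → ℝ
(x *ᴿ y) .seq n = seq x n ℚ.* seq y n
(x *ᴿ y) .cauchy ε 0<ε =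
  let B , 0<B , Nᴮ , ∣x∣≤B = bounded x
      C , 0<C , Nᶜ , ∣y∣≤C = bounded y
      δ , 0<δ , [B+C]δ≡ε = scale-down (B ℚ.+ C) (ℚP.+-mono-< 0<B 0<C) ε 0<ε
      M , closeˣ = cauchy x δ 0<δ
      N , closeʸ = cauchy y δ 0<δ
      K = Nᴮ ℕ.⊔ Nᶜ
  in K ℕ.⊔ (M ℕ.⊔ N) , λ m n m≥ n≥ →
    subst (∣ seq x m ℚ.* seq y m ℚ.- seq x n ℚ.* seq y n ∣ ℚ.≤_) [B+C]δ≡ε
      (∣*-*∣≤ (seq x m) (seq y m) (seq x n) (seq y n) 0<B 0<δ
        (∣x∣≤B m (≤-⊔ˡ {Nᴮ} {Nᶜ} (≤-⊔ˡ {K} {M ℕ.⊔ N} m≥)))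
        (∣y∣≤C n (≤-⊔ʳ {Nᴮ} {Nᶜ} (≤-⊔ˡ {K} {M ℕ.⊔ N} n≥)))
        (closeˣ m n (≤-⊔ˡ {M} {N} (≤-⊔ʳ {K} {M ℕ.⊔ N} m≥))
                    (≤-⊔ˡ {M} {N} (≤-⊔ʳ {K} {M ℕ.⊔ N} n≥)))
        (closeʸ m n (≤-⊔ʳ {M} {N} (≤-⊔ʳ {K} {M ℕ.⊔ N} m≥))
                    (≤-⊔ʳ {M} {N} (≤-⊔ʳ {K} {M ℕ.⊔ N} n≥))))

------------------------------------------------------------------------
-- Real polynomials

-- Coefficient lists, constant term first. Trailing zeros are allowed, so
-- polynomials are compared with _≈ᴾ_.

ℝ[X] : Set
ℝ[X] = List ℝ

coeff : ℝ[X] → ℕ → ℝ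
coeff []      _       = 0ᴿ
coeff (c ∷ _) zero    = c
coeff (_ ∷ p) (suc i) = coeff p i

infix  4 _≈ᴾ_
infixl 6 _+ᴾ_
infixl 7 _*ᴾ_ _·ᴾ_

_≈ᴾ_ : ℝ[X] → ℝ[X] → Set
p ≈ᴾ q = ∀ i → coeff p i ≈ coeff q i

0ᴾ 1ᴾ X : ℝ[X]
0ᴾ = []
1ᴾ = 1ᴿ ∷ []
X  = 0ᴿ ∷ 1ᴿ ∷ []

_+ᴾ_ : ℝ[X] → ℝ[X] → ℝ[X]
[]      +ᴾ q       = q
(c ∷ p) +ᴾ []      = c ∷ p
(c ∷ p) +ᴾ (d ∷ q) = (c +ᴿ d) ∷ (p +ᴾ q)

_·ᴾ_ : ℝ → ℝ[X] → ℝ[X]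
c ·ᴾ p = List.map (c *ᴿ_) p

_*ᴾ_ : ℝ[X] → ℝ[X] → ℝ[X]
[]      *ᴾ q = []
(c ∷ p) *ᴾ q = (c ·ᴾ q) +ᴾ (0ᴿ ∷ p *ᴾ q)

X^_ : ℕ → ℝ[X]
X^ m = replicate m 0ᴿ ++ 1ᴾ

DegreeAtMost : ℕ → ℝ[X] → Set
DegreeAtMost n p = ∀ i → n ℕ.< i → coeff p i ≈ 0ᴿ

HasDegree : ℕ → ℝ[X] → Set
HasDegree n p = coeff p n # 0ᴿ × DegreeAtMost n p

-- xⁿ p(1/x): the coefficient of xⁱ is that of xⁿ⁻ⁱ in p. Meaningful for
-- p of degree at most n only.
𝓘 : ℕ → ℝ[X] → ℝ[X]
𝓘 n p = List.map (λ i → coeff p (n ∸ i)) (upTo (suc n))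

record 𝓘-Decomposition (n : ℕ) (p a b : ℝ[X]) : Set where
  field
    degree-a    : DegreeAtMost n a
    degree-b    : DegreeAtMost (n ∸ 1) b
    sum         : p ≈ᴾ a +ᴾ X *ᴾ b
    symmetric-a : 𝓘 n a ≈ᴾ a
    symmetric-b : 𝓘 (n ∸ 1) b ≈ᴾ b

------------------------------------------------------------------------
-- Real-rootedness and interlacing

∏[X-_] : List ℝ → ℝ[X]
∏[X- rs ] = foldr (λ r q → ((-ᴿ r) ∷ 1ᴿ ∷ []) *ᴾ q) 1ᴾ rs

-- A nonzero polynomial all of whose zeros are real; `zeros` lists them with
-- multiplicity, so that its length is the degree.
record RealRooted (f : ℝ[X]) : Set where
  field
    leading    : ℝ
    leading#0  : leading # 0ᴿ
    zeros      : List ℝ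
    decreasing : Linked _≥_ zeros
    factored   : f ≈ᴾ leading ·ᴾ ∏[X- zeros ]

  degree : ℕ
  degree = length zeros

open RealRooted public

-- r₁ , s₁ , r₂ , s₂ , …
alternate : {A : Set} → List A → List A → List A
alternate []       ss = ss
alternate (r ∷ rs) ss = r ∷ alternate ss rs

-- g ⪯ f. With deg f ∈ {deg g , deg g + 1}, both cases of the definition
-- say that r₁ ≥ s₁ ≥ r₂ ≥ s₂ ≥ ⋯ until the zeros r of f and s of g are
-- exhausted.
Interlaces : ∀ {g f} → RealRooted g → RealRooted f → Set
Interlaces G F =
  (degree F ≡ suc (degree G) ⊎ degree F ≡ degree G) ×
  Linked _≥_ (alternate (zeros F) (zeros G))

SameSign OppositeSign : ℝ → ℝ → Set
SameSign     c d = (0ᴿ < c × 0ᴿ < d) ⊎ (c < 0ᴿ × d < 0ᴿ)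
OppositeSign c d = (0ᴿ < c × d < 0ᴿ) ⊎ (c < 0ᴿ × 0ᴿ < d)

infix 4 _≪_

data _≪_ (g f : ℝ[X]) : Set where
  same-sign     : (G : RealRooted g) (F : RealRooted f) →
                  Interlaces G F → SameSign (leading G) (leading F) → g ≪ f
  opposite-sign : (G : RealRooted g) (F : RealRooted f) →
                  Interlaces F G → OppositeSign (leading G) (leading F) → g ≪ f
  zeroˡ         : g ≈ᴾ 0ᴾ → RealRooted f → g ≪ f
  zeroʳ         : RealRooted g → f ≈ᴾ 0ᴾ → g ≪ f

-- p₀ , pₙ , p₁ , pₙ₋₁ , … increases; the two families of inequalities are
-- the odd and the even steps of this chain, which ends at p_⌊(n+1)/2⌋.
record AlternatinglyIncreasing (n : ℕ) (p : ℝ[X]) : Set where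
  field
    has-degree : HasDegree n p
    0≤p₀       : 0ᴿ ≤ coeff p 0
    pᵢ≤pₙ₋ᵢ    : ∀ i → i ℕ.+ i ℕ.≤ n → coeff p i ≤ coeff p (n ∸ i)
    pₙ₋ᵢ≤pᵢ₊₁  : ∀ i → suc (i ℕ.+ i) ℕ.≤ n → coeff p (n ∸ i) ≤ coeff p (suc i)

------------------------------------------------------------------------
-- Ascent polynomials

Word : ℕ → ℕ → Set
Word k n = Vec (Fin k) n

words : ∀ k n → List (Word k n)
words k zero    = Vec.[] ∷ []
words k (suc n) = cartesianProductWith Vec._∷_ (allFin k) (words k n)

-- The word preceded by w₀ = 0.
padded : ∀ {k n} → Word k n → Vec ℕ (suc n)
padded w = 0 Vec.∷ Vec.map toℕ w

asc : ∀ {k n} → Word k n → ℕ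
asc {k} {n} w = length (filter
  (λ i → lookup (padded w) (inject₁ i) ℕP.<? lookup (padded w) (Fin.suc i))
  (allFin n))

𝒜 : (n k : ℕ) → ℝ[X]
𝒜 n k = foldr (λ w p → X^ (asc w) +ᴾ p) 0ᴾ (words k n)

{-# OPTIONS --safe #-}

-- Let F_j count the words of length n by the number of ascents when they are read after a
-- letter j, so that F_0 = 𝒜 n k. Splitting off the first letter shows that passing from n to
-- n + 1 replaces F_j by Σ_{l ≤ j} F_l + x Σ_{l > j} F_l. Equivalently, the coefficient of xⁱ in
-- F_j is the number of sequences in {0 , … , k - 1}ⁿ⁺¹ with sum j + k i. These numbers are
-- symmetric and unimodal in the sum; hence 𝒜 is alternatingly increasing and its reversal is
-- F_ρ, where ρ = k - 1 - n.
--
-- Write W(u , v) = u v′ - u′ v. The recursion preserves the inequalities W(F_j , F_i) ≥ 0 and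
-- W(F_i , x F_j) ≥ 1 for i < j and all rational x, because the Wronskians of the new polynomials
-- are sums of old ones, with nonnegative coefficients, and of squares. If W(g , f) ≥ 1, then g
-- has the sign of f′ at the roots of f, so g has a root between any two neighbouring roots of f.
-- This yields the roots of F_0 from those of its predecessor, and the interlacing of F_ρ and F_0.
-- Finally b = Σ_{1 ≤ l ≤ ρ} F_l and a = F_0 + x Σ_{l > ρ} F_l with the polynomials F for n - 1,
-- so the same argument applies to a and b. All signs are taken at rational points; reals only
-- enter as limits of bisections.

module Submission where

open import Defs
open import Data.Bool.Base using (Bool; true; false; if_then_else_; T)
open import Data.Fin.Base using (Fin; toℕ; inject₁)
open import Data.Fin.Properties using (toℕ<n)
open import Data.Integer.Base as ℤ using (ℤ; -[1+_]; 0ℤ; 1ℤ) renaming (+_ to ⁺_)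
import Data.Integer.Properties as ℤP
import Data.Integer.Solver as ℤSolver
open import Data.List.Base as List
  using (List; []; _∷_; _++_; map; foldr; length; filter; tabulate; allFin; applyUpTo;
         cartesianProductWith)
open import Data.List.Relation.Unary.All as All using (All; []; _∷_)
open import Data.List.Relation.Unary.AllPairs using (AllPairs; []; _∷_)
open import Data.List.Relation.Unary.Linked using (Linked; []; [-]; _∷_)
open import Data.Nat.Base as ℕ using (ℕ; NonZero; zero; suc; _∸_; s≤s; z≤n)
import Data.Nat.Coprimality as Coprime
import Data.Nat.Properties as ℕP
import Data.Nat.Solver as ℕSolver
open import Data.Product.Base using (Σ; _×_; _,_; proj₁; proj₂)
open import Data.Rational.Base as ℚ
  using (ℚ; mkℚ; 0ℚ; 1ℚ; ½; 1/_; _+_; _*_; _-_; -_; ∣_∣)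
import Data.Rational.Properties as ℚP
open import Data.Rational.Solver using (module +-*-Solver)
import Data.Rational.Unnormalised.Base as ℚᵘ
import Data.Rational.Unnormalised.Properties as ℚᵘP
open import Data.Sum.Base using (_⊎_; inj₁; inj₂)
open import Data.Unit.Base using (tt)
open import Data.Vec.Base as Vec using (Vec; lookup)
open import Function.Base using (_∘_)
open import Relation.Binary.PropositionalEquality
  using (_≡_; refl; sym; trans; cong; cong₂; subst; subst₂; module ≡-Reasoning)
open import Relation.Nullary using (yes; no; contradiction)
open import Relation.Nullary.Decidable using (does; dec-true; dec-false)
open import Relation.Unary using (Decidable)

open +-*-Solver using (solve; _:=_; _:+_; _:*_; _:-_; :-_; con)
private
  module ℕR = ℕSolver.+-*-Solver
  module ℤR = ℤSolver.+-*-Solver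

-- Ordered field arithmetic

p≤q⇒0≤q-p : ∀ {p q} → p ℚ.≤ q → 0ℚ ℚ.≤ q - p
p≤q⇒0≤q-p {p} {q} p≤q = subst (ℚ._≤ q - p) (ℚP.+-inverseʳ p) (ℚP.+-monoˡ-≤ (- p) p≤q)

p<q⇒0<q-p : ∀ {p q} → p ℚ.< q → 0ℚ ℚ.< q - p
p<q⇒0<q-p {p} {q} p<q = subst (ℚ._< q - p) (ℚP.+-inverseʳ p) (ℚP.+-monoˡ-< (- p) p<q)

-- Inequalities are proved by exhibiting q - p as an expression that is visibly nonnegative
-- (positive); the equation is then left to the ring solver.
≤-from-slack : ∀ {r p q} → 0ℚ ℚ.≤ r → p + r ≡ q → p ℚ.≤ q
≤-from-slack {r} {p} 0≤r p+r≡q =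
  subst₂ ℚ._≤_ (ℚP.+-identityʳ p) p+r≡q (ℚP.+-monoʳ-≤ p 0≤r)

<-from-slack : ∀ {r p q} → 0ℚ ℚ.< r → p + r ≡ q → p ℚ.< q
<-from-slack {r} {p} 0<r p+r≡q =
  subst₂ ℚ._<_ (ℚP.+-identityʳ p) p+r≡q (ℚP.+-monoʳ-< p 0<r)

0≤+ : ∀ {p q} → 0ℚ ℚ.≤ p → 0ℚ ℚ.≤ q → 0ℚ ℚ.≤ p + q
0≤+ = ℚP.+-mono-≤

0<+ : ∀ {p q} → 0ℚ ℚ.< p → 0ℚ ℚ.≤ q → 0ℚ ℚ.< p + q
0<+ = ℚP.+-mono-<-≤

0≤* : ∀ {p q} → 0ℚ ℚ.≤ p → 0ℚ ℚ.≤ q → 0ℚ ℚ.≤ p * q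
0≤* {p} {q} 0≤p 0≤q = ℚP.nonNegative⁻¹ (p * q)
  {{ℚP.nonNeg*nonNeg⇒nonNeg p {{ℚ.nonNegative 0≤p}} q {{ℚ.nonNegative 0≤q}}}}

0<* : ∀ {p q} → 0ℚ ℚ.< p → 0ℚ ℚ.< q → 0ℚ ℚ.< p * q
0<* {p} {q} 0<p 0<q = ℚP.positive⁻¹ (p * q)
  {{ℚP.pos*pos⇒pos p {{ℚ.positive 0<p}} q {{ℚ.positive 0<q}}}}

0<1 : 0ℚ ℚ.< 1ℚ
0<1 = ℚP.positive⁻¹ 1ℚ

0≤1 : 0ℚ ℚ.≤ 1ℚ
0≤1 = ℚP.<⇒≤ 0<1

0<½ : 0ℚ ℚ.< ½
0<½ = ℚP.positive⁻¹ ½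

0≤p² : ∀ p → 0ℚ ℚ.≤ p * p
0≤p² p with ℚP.≤-total 0ℚ p
... | inj₁ 0≤p = 0≤* 0≤p 0≤p
... | inj₂ p≤0 = subst (0ℚ ℚ.≤_) (solve 1 (λ p → (:- p) :* (:- p) := p :* p) refl p)
                   (0≤* (ℚP.neg-antimono-≤ p≤0) (ℚP.neg-antimono-≤ p≤0))

p≤∣p∣ : ∀ p → p ℚ.≤ ∣ p ∣
p≤∣p∣ p with ℚP.≤-total 0ℚ p
... | inj₁ 0≤p = ℚP.≤-reflexive (sym (ℚP.0≤p⇒∣p∣≡p 0≤p))
... | inj₂ p≤0 = ℚP.≤-trans p≤0 (ℚP.0≤∣p∣ p)

-p≤∣p∣ : ∀ p → - p ℚ.≤ ∣ p ∣
-p≤∣p∣ p = subst (- p ℚ.≤_) (ℚP.∣-p∣≡∣p∣ p) (p≤∣p∣ (- p))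

∣p∣≤q : ∀ {p q} → p ℚ.≤ q → - p ℚ.≤ q → ∣ p ∣ ℚ.≤ q
∣p∣≤q {p} p≤q -p≤q with ℚP.∣p∣≡p∨∣p∣≡-p p
... | inj₁ eq = subst (ℚ._≤ _) (sym eq) p≤q
... | inj₂ eq = subst (ℚ._≤ _) (sym eq) -p≤q

*-mono-≤ : ∀ {a b c d} → 0ℚ ℚ.≤ a → 0ℚ ℚ.≤ c → a ℚ.≤ b → c ℚ.≤ d → a * c ℚ.≤ b * d
*-mono-≤ {a} {b} {c} {d} 0≤a 0≤c a≤b c≤d = ≤-from-slack
  (0≤+ (0≤* 0≤a (p≤q⇒0≤q-p c≤d)) (0≤* (p≤q⇒0≤q-p a≤b) (ℚP.≤-trans 0≤c c≤d)))
  (solve 4 (λ a b c d → a :* c :+ (a :* (d :- c) :+ (b :- a) :* d) := b :* d) refl a b c d)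

∣*∣≤ : ∀ {a b} p q → ∣ p ∣ ℚ.≤ a → ∣ q ∣ ℚ.≤ b → ∣ p * q ∣ ℚ.≤ a * b
∣*∣≤ {a} {b} p q ∣p∣≤a ∣q∣≤b = subst (ℚ._≤ a * b) (sym (ℚP.∣p*q∣≡∣p∣*∣q∣ p q))
  (*-mono-≤ (ℚP.0≤∣p∣ p) (ℚP.0≤∣p∣ q) ∣p∣≤a ∣q∣≤b)

∣+∣≤ : ∀ {a b} p q → ∣ p ∣ ℚ.≤ a → ∣ q ∣ ℚ.≤ b → ∣ p + q ∣ ℚ.≤ a + b
∣+∣≤ p q ∣p∣≤a ∣q∣≤b = ℚP.≤-trans (ℚP.∣p+q∣≤∣p∣+∣q∣ p q) (ℚP.+-mono-≤ ∣p∣≤a ∣q∣≤b)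

divide : ∀ K → 0ℚ ℚ.< K → ∀ ε → 0ℚ ℚ.< ε → Σ ℚ λ δ → 0ℚ ℚ.< δ × K * δ ≡ ε
divide K 0<K ε 0<ε = 1/ K * ε ,
  0<* (ℚP.positive⁻¹ (1/ K) {{ℚP.1/pos⇒pos K}}) 0<ε ,
  trans (sym (ℚP.*-assoc K (1/ K) ε))
    (trans (cong (_* ε) (ℚP.*-inverseʳ K)) (ℚP.*-identityˡ ε))
  where
  instance
    K-pos = ℚ.positive 0<K
    K-nonZero = ℚP.pos⇒nonZero K

½+½ : ∀ p → ½ * p + ½ * p ≡ p
½+½ p = trans (sym (ℚP.*-distribʳ-+ p ½ ½)) (ℚP.*-identityˡ p)

0<½* : ∀ {p} → 0ℚ ℚ.< p → 0ℚ ℚ.< ½ * p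
0<½* = 0<* 0<½

-- The Archimedean property

-- Written in lowest terms at once, so that comparisons with it reduce to comparisons of integers.
ι : ℕ → ℚ
ι n = mkℚ (ℤ.+ n) 0 (Coprime.sym (Coprime.1-coprimeTo n))

ι-suc : ∀ n → ι (suc n) ≡ 1ℚ + ι n
ι-suc n = ℚP.toℚᵘ-injective (ℚᵘP.≃-trans
  (ℚᵘ.*≡* (cong (ℤ._* ℤ.1ℤ) (cong (ℤ._+_ ℤ.1ℤ) (sym (ℤP.*-identityʳ (ℤ.+ n))))))
  (ℚᵘP.≃-sym (ℚP.toℚᵘ-homo-+ 1ℚ (ι n))))

-- The numerator bounds a nonnegative fraction, because the denominator is at least 1; a negative
-- fraction lies below 0.
archimedean : ∀ p → Σ ℕ λ n → p ℚ.≤ ι n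
archimedean (mkℚ (ℤ.+ m) d c) = m , ℚ.*≤* (ℤP.*-monoˡ-≤-nonNeg (ℤ.+ m) (ℤ.+≤+ (ℕ.s≤s ℕ.z≤n)))
archimedean (mkℚ (ℤ.-[1+ m ]) d c) = 0 , ℚ.*≤* ℤ.-≤+

½^_ : ℕ → ℚ
½^ zero  = 1ℚ
½^ suc n = ½ * ½^ n

0<½^ : ∀ n → 0ℚ ℚ.< ½^ n
0<½^ zero    = 0<1
0<½^ (suc n) = 0<½* (0<½^ n)

-- Bernoulli's inequality `1 + n ≤ 2ⁿ`, multiplied by `½ⁿ` to avoid powers of 2.
½^*ι≤1 : ∀ n → ½^ n * (1ℚ + ι n) ℚ.≤ 1ℚ
½^*ι≤1 zero    = ℚP.≤-refl
½^*ι≤1 (suc n) = subst (λ t → ½ * ½^ n * (1ℚ + t) ℚ.≤ 1ℚ) (sym (ι-suc n)) (≤-from-slack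
  (0≤+ (p≤q⇒0≤q-p (½^*ι≤1 n)) (0≤* (0≤* (ℚP.<⇒≤ 0<½) (ℚP.<⇒≤ (0<½^ n))) 0≤ιn))
  (solve 2 (λ a b → con ½ :* a :* (con 1ℚ :+ (con 1ℚ :+ b)) :+
     ((con 1ℚ :- a :* (con 1ℚ :+ b)) :+ con ½ :* a :* b) := con 1ℚ) refl (½^ n) (ι n)))
  where 0≤ιn = ℚP.nonNegative⁻¹ (ι n)

-- With `n ≥ K / δ` from the Archimedean property, `½ⁿ K ≤ δ ½ⁿ n ≤ δ`.
½^-small : ∀ K δ → 0ℚ ℚ.< δ → Σ ℕ λ n → ½^ n * K ℚ.≤ δ
½^-small K δ 0<δ = n , ≤-from-slack
  (0≤+ (0≤* (ℚP.<⇒≤ (0<½^ n)) (0≤+ (0≤* (ℚP.<⇒≤ 0<δ) (p≤q⇒0≤q-p (proj₂ bound))) (ℚP.<⇒≤ 0<δ)))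
       (0≤* (ℚP.<⇒≤ 0<δ) (p≤q⇒0≤q-p (½^*ι≤1 n))))
  (trans (solve 5 (λ a K δ i b →
            a :* K :+ (a :* (δ :* (b :- K :* i) :+ δ) :+ δ :* (con 1ℚ :- a :* (con 1ℚ :+ b)))
            := δ :+ a :* K :* (con 1ℚ :- δ :* i)) refl (½^ n) K δ δ⁻¹ (ι n))
    (trans (cong (λ t → δ + ½^ n * K * (1ℚ - t)) (ℚP.*-inverseʳ δ))
      (solve 2 (λ δ a → δ :+ a :* (con 1ℚ :- con 1ℚ) := δ) refl δ (½^ n * K))))
  where
  instance
    δ≢0 = ℚP.pos⇒nonZero δ {{ℚ.positive 0<δ}}
  δ⁻¹ = 1/ δ
  bound = archimedean (K * δ⁻¹)
  n = proj₁ bound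

-- Rational polynomials

infixl 6 _⊕_
infixr 7 _⊙_

ℚ[X] : Set
ℚ[X] = List ℚ

-- `dv` is the value of the derivative, by the product rule for `c + x p`.
ev dv : ℚ[X] → ℚ → ℚ
ev []      x = 0ℚ
ev (c ∷ p) x = c + x * ev p x
dv []      x = 0ℚ
dv (c ∷ p) x = ev p x + x * dv p x

co : ℚ[X] → ℕ → ℚ
co []      i       = 0ℚ
co (c ∷ p) zero    = c
co (c ∷ p) (suc i) = co p i

_⊕_ : ℚ[X] → ℚ[X] → ℚ[X]
[]      ⊕ q       = q
(c ∷ p) ⊕ []      = c ∷ p
(c ∷ p) ⊕ (d ∷ q) = (c + d) ∷ (p ⊕ q)

_⊙_ : ℚ → ℚ[X] → ℚ[X]
c ⊙ p = List.map (c *_) p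

ev-⊕ : ∀ p q x → ev (p ⊕ q) x ≡ ev p x + ev q x
ev-⊕ []      q       x = sym (ℚP.+-identityˡ _)
ev-⊕ (c ∷ p) []      x = sym (ℚP.+-identityʳ _)
ev-⊕ (c ∷ p) (d ∷ q) x = trans (cong (λ t → c + d + x * t) (ev-⊕ p q x))
  (solve 5 (λ c d x p q → c :+ d :+ x :* (p :+ q) := c :+ x :* p :+ (d :+ x :* q)) refl
    c d x (ev p x) (ev q x))

dv-⊕ : ∀ p q x → dv (p ⊕ q) x ≡ dv p x + dv q x
dv-⊕ []      q       x = sym (ℚP.+-identityˡ _)
dv-⊕ (c ∷ p) []      x = sym (ℚP.+-identityʳ _)
dv-⊕ (c ∷ p) (d ∷ q) x = trans (cong₂ (λ s t → s + x * t) (ev-⊕ p q x) (dv-⊕ p q x))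
  (solve 5 (λ x p q p′ q′ → p :+ q :+ x :* (p′ :+ q′) := p :+ x :* p′ :+ (q :+ x :* q′)) refl
    x (ev p x) (ev q x) (dv p x) (dv q x))

co-⊕ : ∀ p q i → co (p ⊕ q) i ≡ co p i + co q i
co-⊕ []      q       i       = sym (ℚP.+-identityˡ _)
co-⊕ (c ∷ p) []      i       = sym (ℚP.+-identityʳ _)
co-⊕ (c ∷ p) (d ∷ q) zero    = refl
co-⊕ (c ∷ p) (d ∷ q) (suc i) = co-⊕ p q i

ev-⊙ : ∀ c p x → ev (c ⊙ p) x ≡ c * ev p x
ev-⊙ c []      x = sym (ℚP.*-zeroʳ c)
ev-⊙ c (d ∷ p) x = trans (cong (λ t → c * d + x * t) (ev-⊙ c p x))
  (solve 4 (λ c d x p → c :* d :+ x :* (c :* p) := c :* (d :+ x :* p)) refl c d x (ev p x))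

dv-⊙ : ∀ c p x → dv (c ⊙ p) x ≡ c * dv p x
dv-⊙ c []      x = sym (ℚP.*-zeroʳ c)
dv-⊙ c (d ∷ p) x = trans (cong₂ (λ s t → s + x * t) (ev-⊙ c p x) (dv-⊙ c p x))
  (solve 4 (λ c x p p′ → c :* p :+ x :* (c :* p′) := c :* (p :+ x :* p′)) refl c x (ev p x) (dv p x))

ev-0 : ∀ p → ev p 0ℚ ≡ co p 0
ev-0 []      = refl
ev-0 (c ∷ p) = trans (cong (c +_) (ℚP.*-zeroˡ (ev p 0ℚ))) (ℚP.+-identityʳ c)

-- First and second divided differences; bounds for them are read off the recursion.

Δ Δ² : ℚ[X] → ℚ → ℚ → ℚ
Δ []      x y = 0ℚ
Δ (c ∷ p) x y = ev p x + y * Δ p x y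
Δ² []      x y = 0ℚ
Δ² (c ∷ p) x y = Δ p x y + y * Δ² p x y

ev-Δ : ∀ p x y → ev p x - ev p y ≡ (x - y) * Δ p x y
ev-Δ []      x y = sym (ℚP.*-zeroʳ (x - y))
ev-Δ (c ∷ p) x y = begin
  (c + x * ev p x) - (c + y * ev p y)
    ≡⟨ solve 5 (λ c x y p q → (c :+ x :* p) :- (c :+ y :* q) := (x :- y) :* p :+ y :* (p :- q)) refl
         c x y (ev p x) (ev p y) ⟩
  (x - y) * ev p x + y * (ev p x - ev p y)
    ≡⟨ cong (λ t → (x - y) * ev p x + y * t) (ev-Δ p x y) ⟩
  (x - y) * ev p x + y * ((x - y) * Δ p x y)
    ≡⟨ solve 4 (λ p y d q → d :* p :+ y :* (d :* q) := d :* (p :+ y :* q)) refl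
         (ev p x) y (x - y) (Δ p x y) ⟩
  (x - y) * (ev p x + y * Δ p x y) ∎
  where open ≡-Reasoning

Δ-Δ² : ∀ p x y → Δ p x y - dv p y ≡ (x - y) * Δ² p x y
Δ-Δ² []      x y = sym (ℚP.*-zeroʳ (x - y))
Δ-Δ² (c ∷ p) x y = begin
  (ev p x + y * Δ p x y) - (ev p y + y * dv p y)
    ≡⟨ solve 5 (λ a b y d e → (a :+ y :* d) :- (b :+ y :* e) := (a :- b) :+ y :* (d :- e)) refl
         (ev p x) (ev p y) y (Δ p x y) (dv p y) ⟩
  (ev p x - ev p y) + y * (Δ p x y - dv p y)
    ≡⟨ cong₂ (λ s t → s + y * t) (ev-Δ p x y) (Δ-Δ² p x y) ⟩
  (x - y) * Δ p x y + y * ((x - y) * Δ² p x y)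
    ≡⟨ solve 4 (λ p y d q → d :* p :+ y :* (d :* q) := d :* (p :+ y :* q)) refl
         (Δ p x y) y (x - y) (Δ² p x y) ⟩
  (x - y) * (Δ p x y + y * Δ² p x y) ∎
  where open ≡-Reasoning

module _ (R : ℚ) where

  evBound ΔBound Δ²Bound : ℚ[X] → ℚ
  evBound []      = 0ℚ
  evBound (c ∷ p) = ∣ c ∣ + R * evBound p
  ΔBound []      = 0ℚ
  ΔBound (c ∷ p) = evBound p + R * ΔBound p
  Δ²Bound []      = 0ℚ
  Δ²Bound (c ∷ p) = ΔBound p + R * Δ²Bound p

  ∣ev∣≤ : ∀ p {x} → ∣ x ∣ ℚ.≤ R → ∣ ev p x ∣ ℚ.≤ evBound p
  ∣ev∣≤ []      x≤R = ℚP.≤-refl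
  ∣ev∣≤ (c ∷ p) x≤R = ∣+∣≤ c _ ℚP.≤-refl (∣*∣≤ _ (ev p _) x≤R (∣ev∣≤ p x≤R))

  ∣Δ∣≤ : ∀ p {x y} → ∣ x ∣ ℚ.≤ R → ∣ y ∣ ℚ.≤ R → ∣ Δ p x y ∣ ℚ.≤ ΔBound p
  ∣Δ∣≤ []      x≤R y≤R = ℚP.≤-refl
  ∣Δ∣≤ (c ∷ p) x≤R y≤R = ∣+∣≤ (ev p _) _ (∣ev∣≤ p x≤R) (∣*∣≤ _ (Δ p _ _) y≤R (∣Δ∣≤ p x≤R y≤R))

  -- The derivative obeys the recursion of `Δ` with both points equal and therefore shares its
  -- bound.
  ∣dv∣≤ : ∀ p {x} → ∣ x ∣ ℚ.≤ R → ∣ dv p x ∣ ℚ.≤ ΔBound p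
  ∣dv∣≤ []      x≤R = ℚP.≤-refl
  ∣dv∣≤ (c ∷ p) x≤R = ∣+∣≤ (ev p _) _ (∣ev∣≤ p x≤R) (∣*∣≤ _ (dv p _) x≤R (∣dv∣≤ p x≤R))

  ∣Δ²∣≤ : ∀ p {x y} → ∣ x ∣ ℚ.≤ R → ∣ y ∣ ℚ.≤ R → ∣ Δ² p x y ∣ ℚ.≤ Δ²Bound p
  ∣Δ²∣≤ []      x≤R y≤R = ℚP.≤-refl
  ∣Δ²∣≤ (c ∷ p) x≤R y≤R = ∣+∣≤ (Δ p _ _) _ (∣Δ∣≤ p x≤R y≤R) (∣*∣≤ _ (Δ² p _ _) y≤R (∣Δ²∣≤ p x≤R y≤R))

∣∣-between : ∀ {l x u} → l ℚ.≤ x → x ℚ.≤ u → ∣ x ∣ ℚ.≤ ∣ l ∣ + ∣ u ∣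
∣∣-between {l} {x} {u} l≤x x≤u = ∣p∣≤q
  (ℚP.≤-trans (ℚP.≤-trans x≤u (p≤∣p∣ u))
    (≤-from-slack (ℚP.0≤∣p∣ l) (ℚP.+-comm ∣ u ∣ ∣ l ∣)))
  (ℚP.≤-trans (ℚP.≤-trans (ℚP.neg-antimono-≤ l≤x) (-p≤∣p∣ l))
    (≤-from-slack (ℚP.0≤∣p∣ u) refl))

-- Bisection

module _ (f : ℚ → ℚ) where

  -- The sign conditions are weak: a midpoint where f vanishes can serve as an endpoint, and the
  -- width always stays positive.
  record Bracket : Set where
    field
      lo hi : ℚ
      lo<hi : lo ℚ.< hi
      f-lo  : f lo ℚ.≤ 0ℚ
      f-hi  : 0ℚ ℚ.≤ f hi

    width : ℚ
    width = hi - lo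

    0<width : 0ℚ ℚ.< width
    0<width = p<q⇒0<q-p lo<hi

module _ {f : ℚ → ℚ} where
  open Bracket

  private
    mid : Bracket f → ℚ
    mid b = lo b + ½ * width b

    lo<mid : ∀ b → lo b ℚ.< mid b
    lo<mid b = <-from-slack (0<½* (0<width b)) refl

    mid+ : ∀ b → mid b + ½ * width b ≡ hi b
    mid+ b = trans (ℚP.+-assoc (lo b) _ _) (trans (cong (lo b +_) (½+½ (width b)))
      (solve 2 (λ l h → l :+ (h :- l) := h) refl (lo b) (hi b)))

    mid<hi : ∀ b → mid b ℚ.< hi b
    mid<hi b = <-from-slack (0<½* (0<width b)) (mid+ b)

  halve : ∀ b → Σ (Bracket f) λ h → lo b ℚ.≤ lo h × hi h ℚ.≤ hi b × width h ≡ ½ * width b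
  halve b with ℚP.≤-total 0ℚ (f (mid b))
  ... | inj₁ 0≤fm = record { lo<hi = lo<mid b ; f-lo = f-lo b ; f-hi = 0≤fm } ,
    ℚP.≤-refl , ℚP.<⇒≤ (mid<hi b) , solve 2 (λ l w → (l :+ w) :- l := w) refl (lo b) (½ * width b)
  ... | inj₂ fm≤0 = record { lo<hi = mid<hi b ; f-lo = fm≤0 ; f-hi = f-hi b } ,
    ℚP.<⇒≤ (lo<mid b) , ℚP.≤-refl ,
    trans (cong (_- mid b) (sym (mid+ b))) (solve 2 (λ m w → (m :+ w) :- m := w) refl (mid b) (½ * width b))

  bisect : Bracket f → ℕ → Bracket f
  bisect b zero    = b
  bisect b (suc n) = proj₁ (halve (bisect b n))

  width-bisect : ∀ b n → width (bisect b n) ≡ ½^ n * width b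
  width-bisect b zero    = sym (ℚP.*-identityˡ (width b))
  width-bisect b (suc n) = trans (proj₂ (proj₂ (proj₂ (halve (bisect b n)))))
    (trans (cong (½ *_) (width-bisect b n)) (sym (ℚP.*-assoc ½ (½^ n) (width b))))

  bisect-nested : ∀ b {m n} → m ℕ.≤ n →
                  lo (bisect b m) ℚ.≤ lo (bisect b n) × hi (bisect b n) ℚ.≤ hi (bisect b m)
  bisect-nested b m≤n = go (ℕP.≤⇒≤′ m≤n)
    where
    go : ∀ {m n} → m ℕ.≤′ n → lo (bisect b m) ℚ.≤ lo (bisect b n) × hi (bisect b n) ℚ.≤ hi (bisect b m)
    go ℕ.≤′-refl = ℚP.≤-refl , ℚP.≤-refl
    go {n = suc n} (ℕ.≤′-step m≤n) with go m≤n | halve (bisect b n)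
    ... | l≤ , ≤h | _ , l≤′ , ≤h′ , _ = ℚP.≤-trans l≤ l≤′ , ℚP.≤-trans ≤h′ ≤h

  bisect-narrow : ∀ b δ → 0ℚ ℚ.< δ → Σ ℕ λ n → width (bisect b n) ℚ.≤ δ
  bisect-narrow b δ 0<δ = proj₁ small , subst (ℚ._≤ δ) (sym (width-bisect b (proj₁ small))) (proj₂ small)
    where small = ½^-small (width b) δ 0<δ

dv-Δ : ∀ p x y → dv p y ≡ Δ p x y + (y - x) * Δ² p x y
dv-Δ p x y = begin
  dv p y                                ≡⟨ solve 2 (λ d e → d := e :- (e :- d)) refl (dv p y) (Δ p x y) ⟩
  Δ p x y - (Δ p x y - dv p y)          ≡⟨ cong (λ t → Δ p x y - t) (Δ-Δ² p x y) ⟩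
  Δ p x y - (x - y) * Δ² p x y          ≡⟨ solve 4 (λ d x y e → d :- (x :- y) :* e := d :+ (y :- x) :* e) refl
                                             (Δ p x y) x y (Δ² p x y) ⟩
  Δ p x y + (y - x) * Δ² p x y          ∎
  where open ≡-Reasoning

-- Near a point where f crosses zero upwards f is small and f′ is nearly nonnegative, so
-- g f′ - g′ f ≥ 1 forces g > 0. Here q and q₂ are the divided differences of f.
private
  positive-near-root : ∀ {A A′ B B₂ w} g g′ F f′ q q₂ t →
    1ℚ ℚ.≤ g * f′ - g′ * F → f′ ≡ q + t * q₂ →
    0ℚ ℚ.≤ q → ∣ t ∣ ℚ.≤ w → ∣ F ∣ ℚ.≤ w * q →
    ∣ g ∣ ℚ.≤ A → ∣ g′ ∣ ℚ.≤ A′ → ∣ q ∣ ℚ.≤ B → ∣ q₂ ∣ ℚ.≤ B₂ →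
    w * (A * B₂ + A′ * B) ℚ.< 1ℚ → 0ℚ ℚ.< g
  positive-near-root {A} {A′} {B} {B₂} {w} g g′ F _ q q₂ t W≥1 refl 0≤q t≤w F≤ g≤A g′≤A′ q≤B q₂≤B₂ small
    with 0ℚ ℚP.<? g
  ... | yes 0<g = 0<g
  ... | no  0≮g = contradiction (ℚP.≤-<-trans (ℚP.≤-trans W≥1 W≤) small) (ℚP.<-irrefl refl)
    where
    0≤w = ℚP.≤-trans (ℚP.0≤∣p∣ t) t≤w
    F≤wB : ∣ F ∣ ℚ.≤ w * B
    F≤wB = ℚP.≤-trans F≤ (*-mono-≤ 0≤w 0≤q ℚP.≤-refl (ℚP.≤-trans (p≤∣p∣ q) q≤B))
    -- If `g ≤ 0`, the term `g q` is nonpositive, and the bounds for the two other terms carry a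
    -- factor `w`.
    W≤ : g * (q + t * q₂) - g′ * F ℚ.≤ w * (A * B₂ + A′ * B)
    W≤ = ≤-from-slack
      (0≤+ (0≤* (ℚP.neg-antimono-≤ (ℚP.≮⇒≥ 0≮g)) 0≤q)
        (0≤+ (p≤q⇒0≤q-p (ℚP.≤-trans (p≤∣p∣ _) (∣*∣≤ g (t * q₂) g≤A (∣*∣≤ t q₂ t≤w q₂≤B₂))))
             (p≤q⇒0≤q-p (ℚP.≤-trans (-p≤∣p∣ _) (∣*∣≤ g′ F g′≤A′ F≤wB)))))
      (solve 11 (λ g g′ F q q₂ t A A′ B B₂ w →
        (g :* (q :+ t :* q₂) :- g′ :* F) :+
        ((:- g) :* q :+ ((A :* (w :* B₂) :- g :* (t :* q₂)) :+ (A′ :* (w :* B) :- (:- (g′ :* F)))))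
        := w :* (A :* B₂ :+ A′ :* B)) refl g g′ F q q₂ t A A′ B B₂ w)

module _ (f g : ℚ[X]) (W≥1 : ∀ x → 1ℚ ℚ.≤ ev g x * dv f x - dv g x * ev f x) where
  open Bracket

  -- Bounds for f, g and their differences hold on the whole initial bracket; bisection then makes
  -- the width small enough for `positive-near-root` to apply at both ends.
  positive-at-root : (b : Bracket (ev f)) → Σ (Bracket (ev f)) λ b′ →
    lo b ℚ.≤ lo b′ × hi b′ ℚ.≤ hi b × 0ℚ ℚ.< ev g (lo b′) × 0ℚ ℚ.< ev g (hi b′)
  positive-at-root b = b′ , lo≤ , ≤hi , at-lo , at-hi
    where
    R = ∣ lo b ∣ + ∣ hi b ∣
    A = evBound R g
    A′ = ΔBound R g
    B = ΔBound R f
    B₂ = Δ²Bound R f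
    ∣lo∣≤R : ∣ lo b ∣ ℚ.≤ R
    ∣lo∣≤R = ∣∣-between {u = hi b} ℚP.≤-refl (ℚP.<⇒≤ (lo<hi b))
    -- The summand 1 keeps `K` positive and makes the inequality `small` strict once the width is at
    -- most `1 / K`.
    K = 1ℚ + (A * B₂ + A′ * B)
    0≤bound : 0ℚ ℚ.≤ A * B₂ + A′ * B
    0≤bound = 0≤+
      (0≤* (ℚP.≤-trans (ℚP.0≤∣p∣ _) (∣ev∣≤ R g ∣lo∣≤R)) (ℚP.≤-trans (ℚP.0≤∣p∣ _) (∣Δ²∣≤ R f ∣lo∣≤R ∣lo∣≤R)))
      (0≤* (ℚP.≤-trans (ℚP.0≤∣p∣ _) (∣dv∣≤ R g ∣lo∣≤R)) (ℚP.≤-trans (ℚP.0≤∣p∣ _) (∣Δ∣≤ R f ∣lo∣≤R ∣lo∣≤R)))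
    δ-spec = divide K (0<+ 0<1 0≤bound) 1ℚ 0<1
    δ = proj₁ δ-spec
    narrow = bisect-narrow b δ (proj₁ (proj₂ δ-spec))
    b′ = bisect b (proj₁ narrow)
    w = width b′
    lo≤ = proj₁ (bisect-nested b {n = proj₁ narrow} ℕ.z≤n)
    ≤hi = proj₂ (bisect-nested b {n = proj₁ narrow} ℕ.z≤n)
    ∣lo′∣≤R : ∣ lo b′ ∣ ℚ.≤ R
    ∣lo′∣≤R = ∣∣-between lo≤ (ℚP.≤-trans (ℚP.<⇒≤ (lo<hi b′)) ≤hi)
    ∣hi′∣≤R : ∣ hi b′ ∣ ℚ.≤ R
    ∣hi′∣≤R = ∣∣-between (ℚP.≤-trans lo≤ (ℚP.<⇒≤ (lo<hi b′))) ≤hi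
    small : w * (A * B₂ + A′ * B) ℚ.< 1ℚ
    small = ℚP.≤-<-trans
      (*-mono-≤ (ℚP.<⇒≤ (0<width b′)) 0≤bound (proj₂ narrow) ℚP.≤-refl)
      (<-from-slack (proj₁ (proj₂ δ-spec))
        (trans (solve 2 (λ δ c → δ :* c :+ δ := (con 1ℚ :+ c) :* δ) refl δ (A * B₂ + A′ * B))
          (proj₂ (proj₂ δ-spec))))
    rise = ev f (hi b′) - ev f (lo b′)
    0≤rise : 0ℚ ℚ.≤ rise
    0≤rise = 0≤+ (f-hi b′) (ℚP.neg-antimono-≤ (f-lo b′))
    slope : ∀ d → rise ≡ w * d → 0ℚ ℚ.≤ d
    slope d eq = ℚP.*-cancelˡ-≤-pos w {{ℚ.positive (0<width b′)}}
      (subst₂ ℚ._≤_ (sym (ℚP.*-zeroʳ w)) eq 0≤rise)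
    -- `dv-Δ` gives the derivative at the second argument of `Δ`, so each end needs the chord slope
    -- with its own order of arguments.
    rise-at-lo : rise ≡ w * Δ f (hi b′) (lo b′)
    rise-at-lo = ev-Δ f (hi b′) (lo b′)
    rise-at-hi : rise ≡ w * Δ f (lo b′) (hi b′)
    rise-at-hi = trans (solve 2 (λ u l → u :- l := :- (l :- u)) refl (ev f (hi b′)) (ev f (lo b′)))
      (trans (cong -_ (ev-Δ f (lo b′) (hi b′)))
        (solve 3 (λ l u d → :- ((l :- u) :* d) := (u :- l) :* d) refl (lo b′) (hi b′) (Δ f (lo b′) (hi b′))))
    w≤w : ∣ w ∣ ℚ.≤ w
    w≤w = ℚP.≤-reflexive (ℚP.0≤p⇒∣p∣≡p (ℚP.<⇒≤ (0<width b′)))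
    -w≤w : ∣ lo b′ - hi b′ ∣ ℚ.≤ w
    -w≤w = subst (ℚ._≤ w) (trans (sym (ℚP.∣-p∣≡∣p∣ w))
      (cong ∣_∣ (solve 2 (λ u l → :- (u :- l) := l :- u) refl (hi b′) (lo b′)))) w≤w
    at-hi : 0ℚ ℚ.< ev g (hi b′)
    at-hi = positive-near-root (ev g (hi b′)) (dv g (hi b′)) (ev f (hi b′)) _
      (Δ f (lo b′) (hi b′)) (Δ² f (lo b′) (hi b′)) w (W≥1 (hi b′)) (dv-Δ f (lo b′) (hi b′))
      (slope _ rise-at-hi) w≤w
      (subst₂ ℚ._≤_ (sym (ℚP.0≤p⇒∣p∣≡p (f-hi b′))) rise-at-hi
        (≤-from-slack (ℚP.neg-antimono-≤ (f-lo b′)) refl))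
      (∣ev∣≤ R g ∣hi′∣≤R) (∣dv∣≤ R g ∣hi′∣≤R) (∣Δ∣≤ R f ∣lo′∣≤R ∣hi′∣≤R) (∣Δ²∣≤ R f ∣lo′∣≤R ∣hi′∣≤R) small
    at-lo : 0ℚ ℚ.< ev g (lo b′)
    at-lo = positive-near-root (ev g (lo b′)) (dv g (lo b′)) (ev f (lo b′)) _
      (Δ f (hi b′) (lo b′)) (Δ² f (hi b′) (lo b′)) (lo b′ - hi b′) (W≥1 (lo b′)) (dv-Δ f (hi b′) (lo b′))
      (slope _ rise-at-lo) -w≤w
      (subst₂ ℚ._≤_ (trans (sym (ℚP.0≤p⇒∣p∣≡p (ℚP.neg-antimono-≤ (f-lo b′)))) (ℚP.∣-p∣≡∣p∣ _)) rise-at-lo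
        (≤-from-slack (f-hi b′) (ℚP.+-comm (- ev f (lo b′)) (ev f (hi b′)))))
      (∣ev∣≤ R g ∣lo′∣≤R) (∣dv∣≤ R g ∣lo′∣≤R) (∣Δ∣≤ R f ∣hi′∣≤R ∣lo′∣≤R) (∣Δ²∣≤ R f ∣hi′∣≤R ∣lo′∣≤R) small

-- Wronskians

W : ℚ[X] → ℚ[X] → ℚ → ℚ
W u v x = ev u x * dv v x - dv u x * ev v x

X⊗_ : ℚ[X] → ℚ[X]
X⊗ p = 0ℚ ∷ p

-- Evaluation, differentiation at a point, extraction of a coefficient and the Wronskian in either
-- argument are all of this kind, so facts about `sumP` are proved once for all of them.
record Additive (φ : ℚ[X] → ℚ) : Set where
  field
    zero-homo : φ [] ≡ 0ℚ
    ⊕-homo    : ∀ p q → φ (p ⊕ q) ≡ φ p + φ q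
open Additive

ev-additive : ∀ x → Additive (λ p → ev p x)
ev-additive x = record { zero-homo = refl ; ⊕-homo = λ p q → ev-⊕ p q x }

dv-additive : ∀ x → Additive (λ p → dv p x)
dv-additive x = record { zero-homo = refl ; ⊕-homo = λ p q → dv-⊕ p q x }

co-additive : ∀ i → Additive (λ p → co p i)
co-additive i = record { zero-homo = refl ; ⊕-homo = λ p q → co-⊕ p q i }

W-additiveˡ : ∀ v x → Additive (λ u → W u v x)
W-additiveˡ v x .zero-homo =
  solve 2 (λ v v′ → con 0ℚ :* v′ :- con 0ℚ :* v := con 0ℚ) refl (ev v x) (dv v x)
W-additiveˡ v x .⊕-homo p q = trans
  (cong₂ (λ s t → s * dv v x - t * ev v x) (ev-⊕ p q x) (dv-⊕ p q x))
  (solve 6 (λ v v′ p p′ q q′ → (p :+ q) :* v′ :- (p′ :+ q′) :* v := (p :* v′ :- p′ :* v) :+ (q :* v′ :- q′ :* v)) refl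
    (ev v x) (dv v x) (ev p x) (dv p x) (ev q x) (dv q x))

W-additiveʳ : ∀ u x → Additive (λ v → W u v x)
W-additiveʳ u x .zero-homo =
  solve 2 (λ u u′ → u :* con 0ℚ :- u′ :* con 0ℚ := con 0ℚ) refl (ev u x) (dv u x)
W-additiveʳ u x .⊕-homo p q = trans
  (cong₂ (λ s t → ev u x * t - dv u x * s) (ev-⊕ p q x) (dv-⊕ p q x))
  (solve 6 (λ u u′ p p′ q q′ → u :* (p′ :+ q′) :- u′ :* (p :+ q) := (u :* p′ :- u′ :* p) :+ (u :* q′ :- u′ :* q)) refl
    (ev u x) (dv u x) (ev p x) (dv p x) (ev q x) (dv q x))

WX-additiveʳ : ∀ u x → Additive (λ v → W u (X⊗ v) x)
WX-additiveʳ u x .zero-homo = solve 3 (λ x u u′ →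
  u :* (con 0ℚ :+ x :* con 0ℚ) :- u′ :* (con 0ℚ :+ x :* con 0ℚ) := con 0ℚ) refl x (ev u x) (dv u x)
WX-additiveʳ u x .⊕-homo p q = trans
  (cong₂ (λ s t → ev u x * (s + x * t) - dv u x * (0ℚ + x * s)) (ev-⊕ p q x) (dv-⊕ p q x))
  (solve 7 (λ x u u′ p p′ q q′ → u :* ((p :+ q) :+ x :* (p′ :+ q′)) :- u′ :* (con 0ℚ :+ x :* (p :+ q))
    := (u :* (p :+ x :* p′) :- u′ :* (con 0ℚ :+ x :* p)) :+ (u :* (q :+ x :* q′) :- u′ :* (con 0ℚ :+ x :* q))) refl
    x (ev u x) (dv u x) (ev p x) (dv p x) (ev q x) (dv q x))

sumP : (ℕ → ℚ[X]) → ℕ → ℕ → ℚ[X]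
sumP f a zero    = []
sumP f a (suc d) = f a ⊕ sumP f (suc a) d

module _ {φ : ℚ[X] → ℚ} (φ-add : Additive φ) where

  sumP-split : ∀ f a d e → φ (sumP f a (d ℕ.+ e)) ≡ φ (sumP f a d) + φ (sumP f (a ℕ.+ d) e)
  sumP-split f a zero    e = sym (trans
    (cong₂ _+_ (zero-homo φ-add) (cong (λ t → φ (sumP f t e)) (ℕP.+-identityʳ a)))
    (ℚP.+-identityˡ _))
  sumP-split f a (suc d) e = begin
    φ (f a ⊕ sumP f (suc a) (d ℕ.+ e))
      ≡⟨ ⊕-homo φ-add (f a) _ ⟩
    φ (f a) + φ (sumP f (suc a) (d ℕ.+ e))
      ≡⟨ cong (φ (f a) +_) (sumP-split f (suc a) d e) ⟩
    φ (f a) + (φ (sumP f (suc a) d) + φ (sumP f (suc a ℕ.+ d) e))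
      ≡⟨ sym (ℚP.+-assoc (φ (f a)) _ _) ⟩
    φ (f a) + φ (sumP f (suc a) d) + φ (sumP f (suc a ℕ.+ d) e)
      ≡⟨ cong₂ _+_ (sym (⊕-homo φ-add (f a) _)) (cong (λ t → φ (sumP f t e)) (sym (ℕP.+-suc a d))) ⟩
    φ (sumP f a (suc d)) + φ (sumP f (a ℕ.+ suc d) e) ∎
    where open ≡-Reasoning

  sumP-nonneg : ∀ f a d → (∀ i → a ℕ.≤ i → i ℕ.< a ℕ.+ d → 0ℚ ℚ.≤ φ (f i)) → 0ℚ ℚ.≤ φ (sumP f a d)
  sumP-nonneg f a zero    h = ℚP.≤-reflexive (sym (zero-homo φ-add))
  sumP-nonneg f a (suc d) h = subst (0ℚ ℚ.≤_) (sym (⊕-homo φ-add (f a) _))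
    (0≤+ (h a ℕP.≤-refl (ℕP.m<m+n a (s≤s z≤n)))
      (sumP-nonneg f (suc a) d (λ i a<i i< → h i (ℕP.<⇒≤ a<i) (subst (i ℕ.<_) (sym (ℕP.+-suc a d)) i<))))

  -- The first term alone reaches the bound, and the others are nonnegative.
  sumP-≥1 : ∀ f a d → (∀ i → a ℕ.≤ i → i ℕ.< a ℕ.+ suc d → 1ℚ ℚ.≤ φ (f i)) → 1ℚ ℚ.≤ φ (sumP f a (suc d))
  sumP-≥1 f a d h = subst (1ℚ ℚ.≤_) (sym (⊕-homo φ-add (f a) _))
    (ℚP.≤-trans (h a ℕP.≤-refl (ℕP.m<m+n a (s≤s z≤n)))
      (≤-from-slack (sumP-nonneg f (suc a) d
        (λ i a<i i< → ℚP.≤-trans 0≤1 (h i (ℕP.<⇒≤ a<i) (subst (i ℕ.<_) (sym (ℕP.+-suc a d)) i<)))) refl))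

  sumP-zero : ∀ f a d → (∀ i → a ℕ.≤ i → φ (f i) ≡ 0ℚ) → φ (sumP f a d) ≡ 0ℚ
  sumP-zero f a zero    h = zero-homo φ-add
  sumP-zero f a (suc d) h = trans (⊕-homo φ-add (f a) _)
    (trans (cong₂ _+_ (h a ℕP.≤-refl) (sumP-zero f (suc a) d (λ i a<i → h i (ℕP.<⇒≤ a<i))))
      (ℚP.+-identityˡ 0ℚ))

-- If A, B and C are the sums of the members of a family with index l ≤ i, i < l ≤ j and j < l,
-- then the members i and j of the next family are A + xB + xC and A + B + xC. The first
-- hypothesis is W(A , xB) ≥ 1, the others are that W(B , A), W(B , xC) and W(C , B) are ≥ 0.
private
  step-W : ∀ x a a′ b b′ c c′ →
    1ℚ ℚ.≤ a * (b + x * b′) - a′ * (0ℚ + x * b) →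
    0ℚ ℚ.≤ b * a′ - b′ * a →
    0ℚ ℚ.≤ b * (c + x * c′) - b′ * (0ℚ + x * c) →
    0ℚ ℚ.≤ c * b′ - c′ * b →
    1ℚ ℚ.≤ (a + b + (0ℚ + x * c)) * (a′ + ((b + c) + x * (b′ + c′)))
         - (a′ + b′ + (c + x * c′)) * (a + (0ℚ + x * (b + c)))
  step-W x a a′ b b′ c c′ h₁ h₂ h₃ h₄ = ℚP.≤-trans h₁ (≤-from-slack
    (0≤+ h₂ (0≤+ (0≤p² b) (0≤+ h₃ (0≤* (0≤p² x) h₄))))
    (solve 7 (λ x a a′ b b′ c c′ →
      (a :* (b :+ x :* b′) :- a′ :* (con 0ℚ :+ x :* b)) :+
      ((b :* a′ :- b′ :* a) :+ (b :* b :+ ((b :* (c :+ x :* c′) :- b′ :* (con 0ℚ :+ x :* c)) :+ x :* x :* (c :* b′ :- c′ :* b))))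
      := (a :+ b :+ (con 0ℚ :+ x :* c)) :* (a′ :+ ((b :+ c) :+ x :* (b′ :+ c′)))
         :- (a′ :+ b′ :+ (c :+ x :* c′)) :* (a :+ (con 0ℚ :+ x :* (b :+ c)))) refl x a a′ b b′ c c′))

  step-WX : ∀ x a a′ b b′ c c′ →
    1ℚ ℚ.≤ a * (b + x * b′) - a′ * (0ℚ + x * b) →
    0ℚ ℚ.≤ b * a′ - b′ * a →
    0ℚ ℚ.≤ b * (c + x * c′) - b′ * (0ℚ + x * c) →
    0ℚ ℚ.≤ c * b′ - c′ * b →
    1ℚ ℚ.≤ (a + (0ℚ + x * (b + c))) * ((a + b + (0ℚ + x * c)) + x * (a′ + b′ + (c + x * c′)))
         - (a′ + ((b + c) + x * (b′ + c′))) * (0ℚ + x * (a + b + (0ℚ + x * c)))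
  step-WX x a a′ b b′ c c′ h₁ h₂ h₃ h₄ = ℚP.≤-trans h₁ (≤-from-slack
    (0≤+ (0≤p² (a + x * c)) (0≤+ (0≤* (0≤p² x) h₂) (0≤+ (0≤* (0≤p² x) h₃) (0≤* (0≤p² x) h₄))))
    (solve 7 (λ x a a′ b b′ c c′ →
      (a :* (b :+ x :* b′) :- a′ :* (con 0ℚ :+ x :* b)) :+
      ((a :+ x :* c) :* (a :+ x :* c) :+ (x :* x :* (b :* a′ :- b′ :* a) :+
        (x :* x :* (b :* (c :+ x :* c′) :- b′ :* (con 0ℚ :+ x :* c)) :+ x :* x :* (c :* b′ :- c′ :* b))))
      := (a :+ (con 0ℚ :+ x :* (b :+ c))) :* ((a :+ b :+ (con 0ℚ :+ x :* c)) :+ x :* (a′ :+ b′ :+ (c :+ x :* c′)))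
         :- (a′ :+ ((b :+ c) :+ x :* (b′ :+ c′))) :* (con 0ℚ :+ x :* (a :+ b :+ (con 0ℚ :+ x :* c)))) refl x a a′ b b′ c c′))

-- The letters are 0 , … , κ. For m = n + 1, P m j counts the words w₁⋯wₙ by the number of
-- ascents of j w₁⋯wₙ.

module Family (κ : ℕ) where

  -- Stage 0 is the indicator of `j = 0`: one step turns it into the constant 1 for every `j`, and
  -- its coefficients count the empty sequence by its sum.
  P : ℕ → ℕ → ℚ[X]
  P zero    zero    = 1ℚ ∷ []
  P zero    (suc j) = []
  P (suc m) j       = sumP (P m) 0 (suc j) ⊕ X⊗ sumP (P m) (suc j) (κ ∸ j)

  -- The bound 1 in the second inequality is a quantitative form of strictness. It first holds at
  -- stage 1, where every member has the constant value 1 and `W(1 , x) = 1`.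
  Interlacing : ℕ → Set
  Interlacing m = ∀ {i j} → i ℕ.< j → j ℕ.≤ κ → ∀ x →
    0ℚ ℚ.≤ W (P m j) (P m i) x × 1ℚ ℚ.≤ W (P m i) (X⊗ P m j) x

  module _ (m : ℕ) (I : Interlacing m) {i j : ℕ} (i<j : i ℕ.< j) (j≤κ : j ℕ.≤ κ) (x : ℚ) where
    private
      -- Writing the length `j - i` of `B` as `suc d` exhibits `B` as nonempty, which the bound 1 in
      -- `WX-AB` requires.
      d = j ∸ suc i
      A = sumP (P m) 0 (suc i)
      B = sumP (P m) (suc i) (suc d)
      C = sumP (P m) (suc j) (κ ∸ j)

      i+d : suc i ℕ.+ suc d ≡ suc j
      i+d = trans (ℕP.+-suc (suc i) d) (cong suc (ℕP.m+[n∸m]≡n i<j))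

      d+c : suc d ℕ.+ (κ ∸ j) ≡ κ ∸ i
      d+c = ℕP.+-cancelˡ-≡ (suc i) _ _ (trans (sym (ℕP.+-assoc (suc i) (suc d) (κ ∸ j)))
        (trans (cong (ℕ._+ (κ ∸ j)) i+d) (cong suc (trans (ℕP.m+[n∸m]≡n j≤κ)
          (sym (ℕP.m+[n∸m]≡n (ℕP.≤-trans (ℕP.<⇒≤ i<j) j≤κ)))))))

      split-tail : ∀ {φ} → Additive φ → φ (sumP (P m) (suc i) (κ ∸ i)) ≡ φ B + φ C
      split-tail {φ} φ-add = subst₂ (λ s t → φ (sumP (P m) (suc i) s) ≡ φ B + φ (sumP (P m) t (κ ∸ j)))
        d+c i+d (sumP-split φ-add (P m) (suc i) (suc d) (κ ∸ j))

      split-head : ∀ {φ} → Additive φ → φ (sumP (P m) 0 (suc j)) ≡ φ A + φ B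
      split-head {φ} φ-add = subst (λ s → φ (sumP (P m) 0 s) ≡ φ A + φ B)
        i+d (sumP-split φ-add (P m) 0 (suc i) (suc d))

      ev-Pᵢ : ev (P (suc m) i) x ≡ ev A x + (0ℚ + x * (ev B x + ev C x))
      ev-Pᵢ = trans (ev-⊕ A _ x) (cong (λ t → ev A x + (0ℚ + x * t)) (split-tail (ev-additive x)))
      dv-Pᵢ : dv (P (suc m) i) x ≡ dv A x + ((ev B x + ev C x) + x * (dv B x + dv C x))
      dv-Pᵢ = trans (dv-⊕ A _ x) (cong₂ (λ s t → dv A x + (s + x * t))
        (split-tail (ev-additive x)) (split-tail (dv-additive x)))
      ev-Pⱼ : ev (P (suc m) j) x ≡ ev A x + ev B x + (0ℚ + x * ev C x)
      ev-Pⱼ = trans (ev-⊕ (sumP (P m) 0 (suc j)) _ x) (cong (_+ (0ℚ + x * ev C x)) (split-head (ev-additive x)))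
      dv-Pⱼ : dv (P (suc m) j) x ≡ dv A x + dv B x + (ev C x + x * dv C x)
      dv-Pⱼ = trans (dv-⊕ (sumP (P m) 0 (suc j)) _ x) (cong (_+ (ev C x + x * dv C x)) (split-head (dv-additive x)))

      in-B : ∀ {l} → l ℕ.< suc i ℕ.+ suc d → l ℕ.≤ j
      in-B {l} l< = ℕ.s≤s⁻¹ (subst (l ℕ.<_) i+d l<)
      in-C : ∀ {l} → l ℕ.< suc j ℕ.+ (κ ∸ j) → l ℕ.≤ κ
      in-C {l} l< = ℕ.s≤s⁻¹ (subst (l ℕ.<_) (cong suc (ℕP.m+[n∸m]≡n j≤κ)) l<)

      WX-AB : 1ℚ ℚ.≤ W A (X⊗ B) x
      WX-AB = sumP-≥1 (W-additiveˡ (X⊗ B) x) (P m) 0 i λ l _ l≤i →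
        sumP-≥1 (WX-additiveʳ (P m l) x) (P m) (suc i) d λ l′ i<l′ l′< →
          proj₂ (I (ℕP.<-≤-trans l≤i i<l′) (ℕP.≤-trans (in-B l′<) j≤κ) x)
      W-BA : 0ℚ ℚ.≤ W B A x
      W-BA = sumP-nonneg (W-additiveˡ A x) (P m) (suc i) (suc d) λ l′ i<l′ l′< →
        sumP-nonneg (W-additiveʳ (P m l′) x) (P m) 0 (suc i) λ l _ l≤i →
          proj₁ (I (ℕP.<-≤-trans l≤i i<l′) (ℕP.≤-trans (in-B l′<) j≤κ) x)
      WX-BC : 0ℚ ℚ.≤ W B (X⊗ C) x
      WX-BC = sumP-nonneg (W-additiveˡ (X⊗ C) x) (P m) (suc i) (suc d) λ l _ l< →
        sumP-nonneg (WX-additiveʳ (P m l) x) (P m) (suc j) (κ ∸ j) λ l′ j<l′ l′< →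
          ℚP.≤-trans 0≤1 (proj₂ (I (ℕP.≤-<-trans (in-B l<) j<l′) (in-C l′<) x))
      W-CB : 0ℚ ℚ.≤ W C B x
      W-CB = sumP-nonneg (W-additiveˡ B x) (P m) (suc j) (κ ∸ j) λ l′ j<l′ l′< →
        sumP-nonneg (W-additiveʳ (P m l′) x) (P m) (suc i) (suc d) λ l _ l< →
          proj₁ (I (ℕP.≤-<-trans (in-B l<) j<l′) (in-C l′<) x)

    -- Stronger than what `Interlacing` records: after one step the first Wronskian is also at least
    -- 1. This is the strictness needed to compare a polynomial with its reversal.
    W-suc≥1 : 1ℚ ℚ.≤ W (P (suc m) j) (P (suc m) i) x
    W-suc≥1 = subst (1ℚ ℚ.≤_)
      (sym (cong₂ _-_ (cong₂ _*_ ev-Pⱼ dv-Pᵢ) (cong₂ _*_ dv-Pⱼ ev-Pᵢ)))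
      (step-W x (ev A x) (dv A x) (ev B x) (dv B x) (ev C x) (dv C x) WX-AB W-BA WX-BC W-CB)

    WX-suc≥1 : 1ℚ ℚ.≤ W (P (suc m) i) (X⊗ P (suc m) j) x
    WX-suc≥1 = subst (1ℚ ℚ.≤_)
      (sym (cong₂ _-_
        (cong₂ _*_ ev-Pᵢ (cong₂ (λ s t → s + x * t) ev-Pⱼ dv-Pⱼ))
        (cong₂ _*_ dv-Pᵢ (cong (λ t → 0ℚ + x * t) ev-Pⱼ))))
      (step-WX x (ev A x) (dv A x) (ev B x) (dv B x) (ev C x) (dv C x) WX-AB W-BA WX-BC W-CB)

  interlacing-suc : ∀ m → Interlacing m → Interlacing (suc m)
  interlacing-suc m I i<j j≤κ x =
    ℚP.≤-trans 0≤1 (W-suc≥1 m I i<j j≤κ x) , WX-suc≥1 m I i<j j≤κ x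

  module _ {φ : ℚ[X] → ℚ} (φ-add : Additive φ) where

    sum-P₀-tail : ∀ j d → φ (sumP (P 0) (suc j) d) ≡ 0ℚ
    sum-P₀-tail j d = sumP-zero φ-add (P 0) (suc j) d λ { (suc i) _ → zero-homo φ-add }

    sum-P₀-head : ∀ j → φ (sumP (P 0) 0 (suc j)) ≡ φ (1ℚ ∷ [])
    sum-P₀-head j = trans (⊕-homo φ-add (1ℚ ∷ []) _)
      (trans (cong (φ (1ℚ ∷ []) +_) (sum-P₀-tail 0 j)) (ℚP.+-identityʳ _))

  private
    ev-P₁ : ∀ j x → ev (P 1 j) x ≡ 1ℚ
    ev-P₁ j x = trans (ev-⊕ (sumP (P 0) 0 (suc j)) _ x)
      (trans (cong₂ (λ s t → s + (0ℚ + x * t)) (sum-P₀-head (ev-additive x) j) (sum-P₀-tail (ev-additive x) j (κ ∸ j)))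
        (solve 1 (λ x → (con 1ℚ :+ x :* con 0ℚ) :+ (con 0ℚ :+ x :* con 0ℚ) := con 1ℚ) refl x))

    dv-P₁ : ∀ j x → dv (P 1 j) x ≡ 0ℚ
    dv-P₁ j x = trans (dv-⊕ (sumP (P 0) 0 (suc j)) _ x)
      (trans (cong₂ _+_ (sum-P₀-head (dv-additive x) j)
          (cong₂ (λ s t → s + x * t) (sum-P₀-tail (ev-additive x) j (κ ∸ j)) (sum-P₀-tail (dv-additive x) j (κ ∸ j))))
        (solve 1 (λ x → (con 0ℚ :+ x :* con 0ℚ) :+ (con 0ℚ :+ x :* con 0ℚ) := con 0ℚ) refl x))

  interlacing : ∀ n → Interlacing (suc n)
  interlacing zero {i} {j} i<j j≤κ x
    = ℚP.≤-reflexive (sym (cong₂ _-_ (cong₂ _*_ (ev-P₁ j x) (dv-P₁ i x)) (cong₂ _*_ (dv-P₁ j x) (ev-P₁ i x))))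
    , ℚP.≤-reflexive (sym (trans (cong₂ _-_
        (cong₂ _*_ (ev-P₁ i x) (cong₂ (λ s t → s + x * t) (ev-P₁ j x) (dv-P₁ j x)))
        (cong₂ _*_ (dv-P₁ i x) (cong (λ t → 0ℚ + x * t) (ev-P₁ j x))))
        (solve 1 (λ x → con 1ℚ :* (con 1ℚ :+ x :* con 0ℚ) :- con 0ℚ :* (con 0ℚ :+ x :* con 1ℚ) := con 1ℚ) refl x)))
  interlacing (suc n) = interlacing-suc (suc n) (interlacing n)

-- Alternating signs

-- This is `(-1)ᵈ ε`; negating the argument matches the recursion of `Alternates` and `Isolates`.
sgn : ℚ → ℕ → ℚ
sgn ε zero    = ε
sgn ε (suc d) = sgn (- ε) d

sgn-neg : ∀ ε d → sgn (- ε) d ≡ - sgn ε d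
sgn-neg ε zero    = refl
sgn-neg ε (suc d) = sgn-neg (- ε) d

-ε*-ε : ∀ ε → ε * ε ≡ 1ℚ → (- ε) * (- ε) ≡ 1ℚ
-ε*-ε ε eq = trans (solve 1 (λ ε → (:- ε) :* (:- ε) := ε :* ε) refl ε) eq

-- Signs far to the left

DegreeAtMostℚ : ℕ → ℚ[X] → Set
DegreeAtMostℚ d p = ∀ i → d ℕ.< i → co p i ≡ 0ℚ

co≡0⇒ev≡0 : ∀ p x → (∀ i → co p i ≡ 0ℚ) → ev p x ≡ 0ℚ
co≡0⇒ev≡0 []      x h = refl
co≡0⇒ev≡0 (c ∷ p) x h = trans (cong₂ (λ s t → s + x * t) (h 0) (co≡0⇒ev≡0 p x (h ∘ suc)))
  (solve 1 (λ x → con 0ℚ :+ x :* con 0ℚ := con 0ℚ) refl x)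

-- Induction along Horner's form `c + x p`. A uniform lower bound `δ`, in place of mere positivity,
-- is what lets `x p` outweigh `c`.
sign-at-−∞ : ∀ d p → DegreeAtMostℚ d p → 0ℚ ℚ.< co p d →
  Σ ℚ λ δ → 0ℚ ℚ.< δ × Σ ℚ λ b → ∀ x → x ℚ.≤ b → δ ℚ.≤ sgn 1ℚ d * ev p x
sign-at-−∞ d       []      deg 0<0 = contradiction 0<0 (ℚP.<-irrefl refl)
sign-at-−∞ zero    (c ∷ p) deg 0<c = c , 0<c , 0ℚ , λ x _ → ℚP.≤-reflexive (sym
  (trans (cong (λ t → 1ℚ * (c + x * t)) (co≡0⇒ev≡0 p x (λ i → deg (suc i) (s≤s z≤n))))
    (solve 2 (λ c x → con 1ℚ :* (c :+ x :* con 0ℚ) := c) refl c x)))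
sign-at-−∞ (suc d) (c ∷ p) deg 0<p
  with sign-at-−∞ d p (λ i d<i → deg (suc i) (s≤s d<i)) 0<p
-- `K` solves `δ K = δ + ∣c∣` up to the sign of `c`: for `x ≤ - K` the product `x p` exceeds `∣c∣`
-- by at least `δ` in absolute value.
... | δ , 0<δ , b , p≥δ with divide δ 0<δ (δ + ∣ σ * c ∣) (0<+ 0<δ (ℚP.0≤∣p∣ (σ * c)))
  where σ = sgn 1ℚ (suc d)
... | K , 0<K , δK≡ = δ , 0<δ , b ℚ.⊓ (- K) , λ x x≤ → ≤-from-slack
  (0≤+ (0≤* (ℚP.<⇒≤ 0<δ) (p≤q⇒0≤q-p (ℚP.≤-trans x≤ (ℚP.p⊓q≤q b (- K)))))
    (0≤+ (0≤* (ℚP.≤-trans (ℚP.<⇒≤ 0<K) (subst (ℚ._≤ - x) (solve 1 (λ K → :- (:- K) := K) refl K)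
                (ℚP.neg-antimono-≤ (ℚP.≤-trans x≤ (ℚP.p⊓q≤q b (- K))))))
              (p≤q⇒0≤q-p (p≥δ x (ℚP.≤-trans x≤ (ℚP.p⊓q≤p b (- K))))))
         (p≤q⇒0≤q-p (-p≤∣p∣ (sgn 1ℚ (suc d) * c)))))
  (eq x)
  where
  σ = sgn 1ℚ (suc d)
  s = sgn 1ℚ d
  eq : ∀ x → δ + (δ * (- K - x) + ((- x) * (s * ev p x - δ) + (∣ σ * c ∣ - (- (σ * c))))) ≡ σ * (c + x * ev p x)
  eq x = begin
    δ + (δ * (- K - x) + ((- x) * (s * ev p x - δ) + (∣ σ * c ∣ - (- (σ * c)))))
      ≡⟨ solve 7 (λ δ K x s e m c → δ :+ (δ :* (:- K :- x) :+ ((:- x) :* (s :* e :- δ) :+ (m :- (:- c))))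
           := (δ :+ m) :- δ :* K :+ (c :- x :* s :* e)) refl δ K x s (ev p x) ∣ σ * c ∣ (σ * c) ⟩
    (δ + ∣ σ * c ∣) - δ * K + (σ * c - x * s * ev p x)
      ≡⟨ cong (λ t → (δ + ∣ σ * c ∣) - t + (σ * c - x * s * ev p x)) δK≡ ⟩
    (δ + ∣ σ * c ∣) - (δ + ∣ σ * c ∣) + (σ * c - x * s * ev p x)
      ≡⟨ cong (λ t → (δ + ∣ σ * c ∣) - (δ + ∣ σ * c ∣) + (t * c - x * s * ev p x)) (sgn-neg 1ℚ d) ⟩
    (δ + ∣ σ * c ∣) - (δ + ∣ σ * c ∣) + ((- s) * c - x * s * ev p x)
      ≡⟨ solve 5 (λ m s c x e → m :- m :+ ((:- s) :* c :- x :* s :* e) := (:- s) :* (c :+ x :* e)) refl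
           (δ + ∣ σ * c ∣) s c x (ev p x) ⟩
    (- s) * (c + x * ev p x)
      ≡⟨ cong (_* (c + x * ev p x)) (sym (sgn-neg 1ℚ d)) ⟩
    σ * (c + x * ev p x) ∎
    where open ≡-Reasoning

HasSignBelow : ℚ[X] → ℚ → Set
HasSignBelow p σ = ∀ t → Σ ℚ λ s → s ℚ.< t × 0ℚ ℚ.< σ * ev p s

sign-below : ∀ d p → DegreeAtMostℚ d p → 0ℚ ℚ.< co p d → HasSignBelow p (sgn 1ℚ d)
sign-below d p deg 0<p t with sign-at-−∞ d p deg 0<p
... | δ , 0<δ , b , p≥δ = s ,
  ℚP.≤-<-trans (ℚP.p⊓q≤q b (t - 1ℚ)) (<-from-slack 0<1 (solve 1 (λ t → (t :- con 1ℚ) :+ con 1ℚ := t) refl t)) ,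
  ℚP.<-≤-trans 0<δ (p≥δ s (ℚP.p⊓q≤p b (t - 1ℚ)))
  where s = b ℚ.⊓ (t - 1ℚ)

-- A witness of `d` sign changes of f at points descending from `t`, hence of `d` roots below `t`.
data Alternates (f : ℚ[X]) : ℚ → ℚ → ℕ → Set where
  last : ∀ {ε t} → 0ℚ ℚ.< ε * ev f t → Alternates f ε t 0
  cons : ∀ {ε t s d} → 0ℚ ℚ.< ε * ev f t → s ℚ.< t → Alternates f (- ε) s d → Alternates f ε t (suc d)

-- The conditions on g say that it has the sign of f′ near the isolated roots.
data Isolates (f g : ℚ[X]) : ℚ → ℚ → ℕ → Set where
  []   : ∀ {ε t} → Isolates f g ε t 0
  cons : ∀ {ε t lo hi d} → hi ℚ.≤ t → lo ℚ.< hi →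
         ε * ev f lo ℚ.≤ 0ℚ → 0ℚ ℚ.≤ ε * ev f hi →
         0ℚ ℚ.< ε * ev g lo → 0ℚ ℚ.< ε * ev g hi →
         Isolates f g (- ε) lo d → Isolates f g ε t (suc d)

isolates-weaken : ∀ {f g ε t t′ d} → t ℚ.≤ t′ → Isolates f g ε t d → Isolates f g ε t′ d
isolates-weaken t≤t′ []                       = []
isolates-weaken t≤t′ (cons hi≤t l<h a b c e r) = cons (ℚP.≤-trans hi≤t t≤t′) l<h a b c e r

nonpos : ∀ ε v → 0ℚ ℚ.< (- ε) * v → ε * v ℚ.≤ 0ℚ
nonpos ε v h = ≤-from-slack (ℚP.<⇒≤ h) (solve 2 (λ ε v → ε :* v :+ (:- ε) :* v := con 0ℚ) refl ε v)

flip-sign : ∀ ε v → 0ℚ ℚ.< ε * (- 1ℚ * v) → 0ℚ ℚ.< (- ε) * v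
flip-sign ε v = subst (0ℚ ℚ.<_) (solve 2 (λ ε v → ε :* ((:- con 1ℚ) :* v) := (:- ε) :* v) refl ε v)

head-sign : ∀ {f ε t d} → Alternates f ε t d → 0ℚ ℚ.< ε * ev f t
head-sign (last h)     = h
head-sign (cons h _ _) = h

module _ {f g : ℚ[X]} (W≥1 : ∀ x → 1ℚ ℚ.≤ W g f x) where
  open Bracket

  -- Multiplying f and g by `ε` scales the Wronskian by `ε² = 1` and turns the sign change into an
  -- upward crossing, to which `positive-at-root` applies.
  isolate : ∀ {ε t d} → ε * ε ≡ 1ℚ → Alternates f ε t d → Isolates f g ε t d
  isolate ε²≡1 (last _) = []
  isolate {ε} {t} ε²≡1 (cons {s = s} 0<ft s<t rest) = cons ≤hi (lo<hi b)
    (subst (ℚ._≤ 0ℚ) (ev-⊙ ε f (lo b)) (f-lo b)) (subst (0ℚ ℚ.≤_) (ev-⊙ ε f (hi b)) (f-hi b))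
    (subst (0ℚ ℚ.<_) (ev-⊙ ε g (lo b)) g-lo) (subst (0ℚ ℚ.<_) (ev-⊙ ε g (hi b)) g-hi)
    (isolates-weaken lo≤ (isolate (-ε*-ε ε ε²≡1) rest))
    where
    εW≥1 : ∀ x → 1ℚ ℚ.≤ W (ε ⊙ g) (ε ⊙ f) x
    εW≥1 x = subst (1ℚ ℚ.≤_) (sym (begin
      ev (ε ⊙ g) x * dv (ε ⊙ f) x - dv (ε ⊙ g) x * ev (ε ⊙ f) x
        ≡⟨ cong₂ _-_ (cong₂ _*_ (ev-⊙ ε g x) (dv-⊙ ε f x)) (cong₂ _*_ (dv-⊙ ε g x) (ev-⊙ ε f x)) ⟩
      (ε * ev g x) * (ε * dv f x) - (ε * dv g x) * (ε * ev f x)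
        ≡⟨ solve 5 (λ ε g g′ f f′ → (ε :* g) :* (ε :* f′) :- (ε :* g′) :* (ε :* f) := ε :* ε :* (g :* f′ :- g′ :* f)) refl
             ε (ev g x) (dv g x) (ev f x) (dv f x) ⟩
      ε * ε * W g f x
        ≡⟨ trans (cong (_* W g f x) ε²≡1) (ℚP.*-identityˡ (W g f x)) ⟩
      W g f x ∎)) (W≥1 x)
      where open ≡-Reasoning
    start : Bracket (ev (ε ⊙ f))
    start = record
      { lo<hi = s<t
      ; f-lo  = subst (ℚ._≤ 0ℚ) (sym (ev-⊙ ε f s)) (nonpos ε (ev f s) (head-sign rest))
      ; f-hi  = subst (0ℚ ℚ.≤_) (sym (ev-⊙ ε f t)) (ℚP.<⇒≤ 0<ft)
      }
    narrowed = positive-at-root (ε ⊙ f) (ε ⊙ g) εW≥1 start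
    b = proj₁ narrowed
    lo≤ = proj₁ (proj₂ narrowed)
    ≤hi = proj₁ (proj₂ (proj₂ narrowed))
    g-lo = proj₁ (proj₂ (proj₂ (proj₂ narrowed)))
    g-hi = proj₂ (proj₂ (proj₂ (proj₂ narrowed)))

-- The signs of h alternate along `t` and the lower ends of the isolating intervals; a point far to
-- the left adds one more change.
alternates-extend : ∀ {f h ε t d} → Isolates f (- 1ℚ ⊙ h) ε t d → 0ℚ ℚ.< ε * ev h t →
                    HasSignBelow h (sgn ε (suc d)) → Alternates h ε t (suc d)
alternates-extend {t = t} [] 0<ht below with below t
... | s , s<t , 0<hs = cons 0<ht s<t (last 0<hs)
alternates-extend {h = h} (cons {ε} {lo = lo} hi≤t lo<hi _ _ g-lo _ rest) 0<ht below =
  cons 0<ht (ℚP.<-≤-trans lo<hi hi≤t)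
    (alternates-extend rest (flip-sign ε (ev h lo) (subst (λ v → 0ℚ ℚ.< ε * v) (ev-⊙ (- 1ℚ) h lo) g-lo)) below)

-- By W f h ≥ 1, the polynomial h has the sign of -f′ at the roots of f.
alternates-next : ∀ {f h d} → (∀ x → 1ℚ ℚ.≤ W f h x) → Alternates f 1ℚ 0ℚ d →
                  0ℚ ℚ.< co h 0 → DegreeAtMostℚ (suc d) h → 0ℚ ℚ.< co h (suc d) →
                  Alternates h 1ℚ 0ℚ (suc d)
alternates-next {f} {h} {d} W≥1 alt 0<h₀ deg 0<lead = alternates-extend (isolate -W≥1 refl alt)
  (subst (0ℚ ℚ.<_) (sym (trans (ℚP.*-identityˡ _) (ev-0 h))) 0<h₀) (sign-below (suc d) h deg 0<lead)
  where
  -W≥1 : ∀ x → 1ℚ ℚ.≤ W (- 1ℚ ⊙ h) f x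
  -W≥1 x = subst (1ℚ ℚ.≤_) (sym (trans
    (cong₂ (λ s t → s * dv f x - t * ev f x) (ev-⊙ (- 1ℚ) h x) (dv-⊙ (- 1ℚ) h x))
    (solve 4 (λ f f′ h h′ → ((:- con 1ℚ) :* h) :* f′ :- ((:- con 1ℚ) :* h′) :* f := f :* h′ :- f′ :* h) refl
      (ev f x) (dv f x) (ev h x) (dv h x)))) (W≥1 x)

-- Window sums

window : (ℤ → ℚ) → ℤ → ℕ → ℚ
window h s zero    = 0ℚ
window h s (suc d) = h s + window h (ℤ.suc s) d

window-split : ∀ h s d e → window h s (d ℕ.+ e) ≡ window h s d + window h (s ℤ.+ ⁺ d) e
window-split h s zero    e = sym (trans (ℚP.+-identityˡ _) (cong (λ t → window h t e) (ℤP.+-identityʳ s)))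
window-split h s (suc d) e = trans (cong (h s +_) (window-split h (ℤ.suc s) d e))
  (trans (sym (ℚP.+-assoc (h s) _ _))
    (cong (λ t → h s + window h (ℤ.suc s) d + window h t e)
      (ℤR.solve 2 (λ s d → (ℤR.con 1ℤ ℤR.:+ s) ℤR.:+ d ℤR.:= s ℤR.:+ (ℤR.con 1ℤ ℤR.:+ d)) refl s (⁺ d))))

window-snoc : ∀ h s d → window h s (suc d) ≡ window h s d + h (s ℤ.+ ⁺ d)
window-snoc h s d = trans (cong (window h s) (ℕP.+-comm 1 d))
  (trans (window-split h s d 1) (cong (window h s d +_) (ℚP.+-identityʳ _)))

window-zero : ∀ h s d → (∀ i → i ℕ.< d → h (s ℤ.+ ⁺ i) ≡ 0ℚ) → window h s d ≡ 0ℚ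
window-zero h s zero    z = refl
window-zero h s (suc d) z = trans (window-snoc h s d)
  (trans (cong₂ _+_ (window-zero h s d (λ i i<d → z i (ℕP.m<n⇒m<1+n i<d))) (z d ℕP.≤-refl)) (ℚP.+-identityˡ 0ℚ))

window-nonneg : ∀ h s d → (∀ t → 0ℚ ℚ.≤ h t) → 0ℚ ℚ.≤ window h s d
window-nonneg h s zero    0≤h = ℚP.≤-refl
window-nonneg h s (suc d) 0≤h = 0≤+ (0≤h s) (window-nonneg h (ℤ.suc s) d 0≤h)

-- The reflection carries `s , … , s + d - 1` to `c - s - d + 1 , … , c - s`.
window-reverse : ∀ h c → (∀ t → h t ≡ h (c ℤ.- t)) → ∀ s d →
                 window h s d ≡ window h (c ℤ.- s ℤ.- ⁺ d ℤ.+ 1ℤ) d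
window-reverse h c sym-h s zero    = refl
window-reverse h c sym-h s (suc d) = begin
  h s + window h (ℤ.suc s) d
    ≡⟨ cong₂ _+_ (sym-h s) (window-reverse h c sym-h (ℤ.suc s) d) ⟩
  h (c ℤ.- s) + window h (c ℤ.- ℤ.suc s ℤ.- ⁺ d ℤ.+ 1ℤ) d
    ≡⟨ ℚP.+-comm (h (c ℤ.- s)) _ ⟩
  window h (c ℤ.- ℤ.suc s ℤ.- ⁺ d ℤ.+ 1ℤ) d + h (c ℤ.- s)
    ≡⟨ cong₂ (λ u v → window h u d + h v)
         (ℤR.solve 3 (λ c s d → c ℤR.:- (ℤR.con 1ℤ ℤR.:+ s) ℤR.:- d ℤR.:+ ℤR.con 1ℤ
            ℤR.:= c ℤR.:- s ℤR.:- (ℤR.con 1ℤ ℤR.:+ d) ℤR.:+ ℤR.con 1ℤ) refl c s (⁺ d))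
         (ℤR.solve 3 (λ c s d → c ℤR.:- s
            ℤR.:= (c ℤR.:- s ℤR.:- (ℤR.con 1ℤ ℤR.:+ d) ℤR.:+ ℤR.con 1ℤ) ℤR.:+ d) refl c s (⁺ d)) ⟩
  window h u d + h (u ℤ.+ ⁺ d)
    ≡⟨ sym (window-snoc h u d) ⟩
  window h u (suc d) ∎
  where
  open ≡-Reasoning
  u = c ℤ.- s ℤ.- ⁺ suc d ℤ.+ 1ℤ

-- Coefficients as numbers of sequences with a given sum

module Coefficients (κ : ℕ) where
  open Family κ

  -- The number of sequences in {0 , … , κ}ᵐ with sum s.
  w : ℕ → ℤ → ℚ
  w zero    (⁺ zero) = 1ℚ
  w zero    (⁺ suc _) = 0ℚ
  w zero    -[1+ _ ] = 0ℚ
  w (suc m) s = window (w m) (s ℤ.- ⁺ κ) (suc κ)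

  w-nonneg : ∀ m s → 0ℚ ℚ.≤ w m s
  w-nonneg zero    (⁺ zero)  = 0≤1
  w-nonneg zero    (⁺ suc _) = ℚP.≤-refl
  w-nonneg zero    -[1+ _ ]  = ℚP.≤-refl
  w-nonneg (suc m) s = window-nonneg (w m) _ (suc κ) (w-nonneg m)

  w-negative : ∀ m s → s ℤ.< 0ℤ → w m s ≡ 0ℚ
  w-negative zero    (⁺ zero)  (ℤ.+<+ ())
  w-negative zero    (⁺ suc _) s<0 = refl
  w-negative zero    -[1+ _ ]  s<0 = refl
  w-negative (suc m) s s<0 = window-zero (w m) _ (suc κ) λ i i≤κ → w-negative m _
    (ℤP.≤-<-trans (ℤP.≤-trans
      (ℤP.+-monoʳ-≤ (s ℤ.- ⁺ κ) (ℤ.+≤+ (ℕ.s≤s⁻¹ i≤κ)))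
      (ℤP.≤-reflexive (ℤR.solve 2 (λ s k → s ℤR.:- k ℤR.:+ k ℤR.:= s) refl s (⁺ κ)))) s<0)

  -- Replacing every entry e by `κ - e` turns the sum `s` into `m κ - s`; in the recursion this
  -- reflects the window.
  w-symmetric : ∀ m s → w m s ≡ w m (⁺ (m ℕ.* κ) ℤ.- s)
  w-symmetric zero    (⁺ zero)  = refl
  w-symmetric zero    (⁺ suc _) = refl
  w-symmetric zero    -[1+ _ ]  = refl
  w-symmetric (suc m) s = trans (window-reverse (w m) (⁺ (m ℕ.* κ)) (w-symmetric m) (s ℤ.- ⁺ κ) (suc κ))
    (cong (λ t → window (w m) t (suc κ))
      (ℤR.solve 3 (λ D s k → D ℤR.:- (s ℤR.:- k) ℤR.:- (ℤR.con 1ℤ ℤR.:+ k) ℤR.:+ ℤR.con 1ℤ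
        ℤR.:= (k ℤR.:+ D) ℤR.:- s ℤR.:- k) refl (⁺ (m ℕ.* κ)) s (⁺ κ)))

  w-above : ∀ m s → ⁺ (m ℕ.* κ) ℤ.< s → w m s ≡ 0ℚ
  w-above m s D<s = trans (w-symmetric m s) (w-negative m _
    (subst (ℤ._< 0ℤ) (ℤP.+-comm (ℤ.- s) (⁺ (m ℕ.* κ)))
      (subst (ℤ.- s ℤ.+ ⁺ (m ℕ.* κ) ℤ.<_) (ℤP.+-inverseˡ s) (ℤP.+-monoʳ-< (ℤ.- s) D<s))))

  w-0 : ∀ m → w m 0ℤ ≡ 1ℚ
  w-0 zero    = refl
  w-0 (suc m) = trans (window-snoc (w m) (0ℤ ℤ.- ⁺ κ) κ)
    (trans (cong₂ _+_
        (window-zero (w m) _ κ λ i i<κ → w-negative m _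
          (subst (0ℤ ℤ.- ⁺ κ ℤ.+ ⁺ i ℤ.<_) (−κ+κ) (ℤP.+-monoʳ-< (0ℤ ℤ.- ⁺ κ) (ℤ.+<+ i<κ))))
        (trans (cong (w m) −κ+κ) (w-0 m)))
      (ℚP.+-identityˡ 1ℚ))
    where
    −κ+κ : 0ℤ ℤ.- ⁺ κ ℤ.+ ⁺ κ ≡ 0ℤ
    −κ+κ = ℤR.solve 1 (λ k → ℤR.con 0ℤ ℤR.:- k ℤR.:+ k ℤR.:= ℤR.con 0ℤ) refl (⁺ κ)

  -- Compares any two arguments whose midpoint does not exceed the centre `m κ / 2`. The larger one
  -- may lie beyond the centre, as happens in `w-step`.
  Unimodal : ℕ → Set
  Unimodal m = ∀ d s → s ℤ.+ (s ℤ.+ ⁺ d) ℤ.≤ ⁺ (m ℕ.* κ) → w m s ℚ.≤ w m (s ℤ.+ ⁺ d)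

  -- Moving the window by one place drops the value at `s - κ` and gains the one at `s + 1`; the
  -- hypothesis puts the midpoint of these two at or left of the centre for `m`.
  w-step : ∀ m → Unimodal m → ∀ s → s ℤ.+ (s ℤ.+ 1ℤ) ℤ.≤ ⁺ (suc m ℕ.* κ) → w (suc m) s ℚ.≤ w (suc m) (s ℤ.+ 1ℤ)

  w-step m U s h = subst₂ ℚ._≤_
    (ℚP.+-comm (window (w m) (ℤ.suc (s ℤ.- ⁺ κ)) κ) (w m (s ℤ.- ⁺ κ)))
    (sym (trans (cong (λ t → window (w m) t (suc κ)) (ℤR.solve 2 (λ s k → (s ℤR.:+ ℤR.con 1ℤ) ℤR.:- k
        ℤR.:= ℤR.con 1ℤ ℤR.:+ (s ℤR.:- k)) refl s (⁺ κ))) (window-snoc (w m) _ κ)))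
    (ℚP.+-monoʳ-≤ (window (w m) (ℤ.suc (s ℤ.- ⁺ κ)) κ)
      (subst (λ t → w m (s ℤ.- ⁺ κ) ℚ.≤ w m t)
        (ℤR.solve 2 (λ s k → (s ℤR.:- k) ℤR.:+ (ℤR.con 1ℤ ℤR.:+ k) ℤR.:= (ℤR.con 1ℤ ℤR.:+ (s ℤR.:- k)) ℤR.:+ k) refl s (⁺ κ))
        (U (suc κ) (s ℤ.- ⁺ κ)
          (subst₂ ℤ._≤_
            (ℤR.solve 2 (λ s k → s ℤR.:+ (s ℤR.:+ ℤR.con 1ℤ) ℤR.:- k
              ℤR.:= (s ℤR.:- k) ℤR.:+ ((s ℤR.:- k) ℤR.:+ (ℤR.con 1ℤ ℤR.:+ k))) refl s (⁺ κ))
            (ℤR.solve 2 (λ D k → (k ℤR.:+ D) ℤR.:- k ℤR.:= D) refl (⁺ (m ℕ.* κ)) (⁺ κ))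
            (ℤP.+-monoˡ-≤ (ℤ.- ⁺ κ) h)))))

  -- Induction on the distance. If the midpoint is the centre, the two arguments are reflections of
  -- each other; otherwise there is room to move the left one up by 1 with the right one fixed.
  unimodal-suc : ∀ m → Unimodal m → Unimodal (suc m)
  unimodal-suc m U zero s h = ℚP.≤-reflexive (cong (w (suc m)) (sym (ℤP.+-identityʳ s)))
  unimodal-suc m U (suc d) s h with s ℤ.+ (s ℤ.+ ⁺ suc d) ℤP.≟ ⁺ (suc m ℕ.* κ)
  ... | yes eq = ℚP.≤-reflexive (trans (w-symmetric (suc m) s) (cong (w (suc m))
    (trans (cong (ℤ._- s) (sym eq))
      (ℤR.solve 2 (λ s d → s ℤR.:+ (s ℤR.:+ d) ℤR.:- s ℤR.:= s ℤR.:+ d) refl s (⁺ suc d)))))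
  ... | no  ne = ℚP.≤-trans
    (w-step m U s (ℤP.≤-trans (ℤP.+-monoʳ-≤ s (ℤP.+-monoʳ-≤ s (ℤ.+≤+ (s≤s z≤n)))) h))
    (subst (λ t → w (suc m) (s ℤ.+ 1ℤ) ℚ.≤ w (suc m) t)
      (ℤR.solve 2 (λ s d → (s ℤR.:+ ℤR.con 1ℤ) ℤR.:+ d ℤR.:= s ℤR.:+ (ℤR.con 1ℤ ℤR.:+ d)) refl s (⁺ d))
      (unimodal-suc m U d (s ℤ.+ 1ℤ)
        (subst (ℤ._≤ ⁺ (suc m ℕ.* κ))
          (ℤR.solve 2 (λ s d → ℤR.con 1ℤ ℤR.:+ (s ℤR.:+ (s ℤR.:+ (ℤR.con 1ℤ ℤR.:+ d)))
            ℤR.:= (s ℤR.:+ ℤR.con 1ℤ) ℤR.:+ ((s ℤR.:+ ℤR.con 1ℤ) ℤR.:+ d)) refl s (⁺ d))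
          (ℤP.i<j⇒suc[i]≤j (ℤP.≤∧≢⇒< h ne)))))

  unimodal : ∀ m → Unimodal m
  unimodal zero    zero    s h = ℚP.≤-reflexive (cong (w 0) (sym (ℤP.+-identityʳ s)))
  unimodal zero    (suc d) (⁺ zero)  (ℤ.+≤+ ())
  unimodal zero    (suc d) (⁺ suc s) h = w-nonneg 0 (⁺ suc s ℤ.+ ⁺ suc d)
  unimodal zero    (suc d) -[1+ n ]  h = w-nonneg 0 (-[1+ n ] ℤ.+ ⁺ suc d)
  unimodal (suc m) = unimodal-suc m (unimodal m)

  w-mono : ∀ m {s t} → s ℕ.≤ t → s ℕ.+ t ℕ.≤ m ℕ.* κ → w m (⁺ s) ℚ.≤ w m (⁺ t)
  w-mono m {s} {t} s≤t s+t≤ = subst (λ u → w m (⁺ s) ℚ.≤ w m (⁺ u)) (ℕP.m+[n∸m]≡n s≤t)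
    (unimodal m (t ∸ s) (⁺ s) (ℤ.+≤+ (subst (λ u → s ℕ.+ u ℕ.≤ m ℕ.* κ) (sym (ℕP.m+[n∸m]≡n s≤t)) s+t≤)))

  w≥1 : ∀ m {t} → t ℕ.≤ m ℕ.* κ → 1ℚ ℚ.≤ w m (⁺ t)
  w≥1 m {t} t≤ = subst (ℚ._≤ w m (⁺ t)) (w-0 m) (w-mono m z≤n t≤)

  -- The members `l ≤ j` contribute the arguments `i k , … , i k + j` with `k = κ + 1`, and the
  -- members `l > j`, shifted by x, contribute `j + i k - κ , … , i k - 1`. Together they fill the
  -- window that defines `w (suc m)`.
  co-P : ∀ m j i → j ℕ.≤ κ → co (P m j) i ≡ w m (⁺ (j ℕ.+ i ℕ.* suc κ))

  co-sumP : ∀ m a d i → a ℕ.+ d ℕ.≤ suc κ → co (sumP (P m) a d) i ≡ window (w m) (⁺ (a ℕ.+ i ℕ.* suc κ)) d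
  co-sumP m a zero    i h = refl
  co-sumP m a (suc d) i h = trans (co-⊕ (P m a) _ i)
    (cong₂ _+_ (co-P m a i (ℕ.s≤s⁻¹ (ℕP.≤-trans (ℕP.m<m+n a (s≤s z≤n)) h)))
               (co-sumP m (suc a) d i (subst (ℕ._≤ suc κ) (ℕP.+-suc a d) h)))

  co-P zero    zero    zero    j≤κ = refl
  co-P zero    zero    (suc i) j≤κ = refl
  co-P zero    (suc j) i       j≤κ = refl
  co-P (suc m) j i j≤κ = begin
    co (P (suc m) j) i
      ≡⟨ co-⊕ (sumP (P m) 0 (suc j)) (X⊗ sumP (P m) (suc j) (κ ∸ j)) i ⟩
    co (sumP (P m) 0 (suc j)) i + co (X⊗ sumP (P m) (suc j) (κ ∸ j)) i
      ≡⟨ ℚP.+-comm (co (sumP (P m) 0 (suc j)) i) _ ⟩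
    co (X⊗ sumP (P m) (suc j) (κ ∸ j)) i + co (sumP (P m) 0 (suc j)) i
      ≡⟨ cong₂ _+_ (low i) (trans (co-sumP m 0 (suc j) i (s≤s j≤κ)) (cong (λ t → window (w m) t (suc j)) (start i))) ⟩
    window (w m) (⁺ (j ℕ.+ i ℕ.* suc κ) ℤ.- ⁺ κ) (κ ∸ j) + window (w m) (⁺ (j ℕ.+ i ℕ.* suc κ) ℤ.- ⁺ κ ℤ.+ ⁺ (κ ∸ j)) (suc j)
      ≡⟨ sym (window-split (w m) (⁺ (j ℕ.+ i ℕ.* suc κ) ℤ.- ⁺ κ) (κ ∸ j) (suc j)) ⟩
    window (w m) (⁺ (j ℕ.+ i ℕ.* suc κ) ℤ.- ⁺ κ) (κ ∸ j ℕ.+ suc j)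
      ≡⟨ cong (window (w m) _) (trans (ℕP.+-suc (κ ∸ j) j) (cong suc (ℕP.m∸n+n≡m j≤κ))) ⟩
    w (suc m) (⁺ (j ℕ.+ i ℕ.* suc κ)) ∎
    where
    open ≡-Reasoning
    κ≡ : ⁺ j ℤ.+ ⁺ (κ ∸ j) ≡ ⁺ κ
    κ≡ = cong ⁺_ (ℕP.m+[n∸m]≡n j≤κ)
    start : ∀ i → ⁺ (i ℕ.* suc κ) ≡ ⁺ (j ℕ.+ i ℕ.* suc κ) ℤ.- ⁺ κ ℤ.+ ⁺ (κ ∸ j)
    start i = trans (ℤR.solve 3 (λ j e t → t ℤR.:= (j ℤR.:+ t) ℤR.:- (j ℤR.:+ e) ℤR.:+ e) refl (⁺ j) (⁺ (κ ∸ j)) (⁺ (i ℕ.* suc κ)))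
      (cong (λ u → ⁺ (j ℕ.+ i ℕ.* suc κ) ℤ.- u ℤ.+ ⁺ (κ ∸ j)) κ≡)
    low : ∀ i → co (X⊗ sumP (P m) (suc j) (κ ∸ j)) i ≡ window (w m) (⁺ (j ℕ.+ i ℕ.* suc κ) ℤ.- ⁺ κ) (κ ∸ j)
    -- The shifted sum has no constant term; correspondingly this part of the window consists of
    -- negative arguments.
    low zero = sym (window-zero (w m) _ (κ ∸ j) λ l l< → w-negative m _
      (subst (⁺ (j ℕ.+ 0) ℤ.- ⁺ κ ℤ.+ ⁺ l ℤ.<_) (sym (start 0)) (ℤP.+-monoʳ-< (⁺ (j ℕ.+ 0) ℤ.- ⁺ κ) (ℤ.+<+ l<))))
    low (suc i) = trans (co-sumP m (suc j) (κ ∸ j) i (ℕP.≤-reflexive (cong suc (ℕP.m+[n∸m]≡n j≤κ))))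
      (cong (λ t → window (w m) t (κ ∸ j))
        (ℤR.solve 3 (λ j k t → ℤR.con 1ℤ ℤR.:+ (j ℤR.:+ t)
          ℤR.:= (j ℤR.:+ ((ℤR.con 1ℤ ℤR.:+ k) ℤR.:+ t)) ℤR.:- k) refl (⁺ j) (⁺ κ) (⁺ (i ℕ.* suc κ))))

  P-degree : ∀ n j → j ℕ.≤ κ → DegreeAtMostℚ n (P (suc n) j)
  P-degree n j j≤κ i n<i = trans (co-P (suc n) j i j≤κ) (w-above (suc n) _ (ℤ.+<+ (begin-strict
    suc n ℕ.* κ              <⟨ ℕP.*-monoʳ-< (suc n) (ℕP.n<1+n κ) ⟩
    suc n ℕ.* suc κ          ≤⟨ ℕP.*-monoˡ-≤ (suc κ) n<i ⟩
    i ℕ.* suc κ              ≤⟨ ℕP.m≤n+m (i ℕ.* suc κ) j ⟩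
    j ℕ.+ i ℕ.* suc κ        ∎)))
    where open ℕP.≤-Reasoning

-- Words

-- Only the Boolean answers are compared, so the positions after the first in a word can be matched
-- with all positions of its tail.
length-filter-tabulate : ∀ {A B : Set} {P : A → Set} {Q : B → Set} (P? : Decidable P) (Q? : Decidable Q)
  {n} (f : Fin n → A) (g : Fin n → B) → (∀ i → does (P? (f i)) ≡ does (Q? (g i))) →
  length (filter P? (tabulate f)) ≡ length (filter Q? (tabulate g))
length-filter-tabulate P? Q? {zero}  f g eq = refl
length-filter-tabulate P? Q? {suc n} f g eq
  with does (P? (f Fin.zero)) | does (Q? (g Fin.zero)) | eq Fin.zero
... | true  | true  | refl = cong suc (length-filter-tabulate P? Q? (f ∘ Fin.suc) (g ∘ Fin.suc) (eq ∘ Fin.suc))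
... | false | false | refl = length-filter-tabulate P? Q? (f ∘ Fin.suc) (g ∘ Fin.suc) (eq ∘ Fin.suc)

ascFrom : ∀ {k n} → ℕ → Word k n → ℕ
ascFrom v Vec.[]      = 0
ascFrom v (u Vec.∷ w) = if does (v ℕP.<? toℕ u) then suc (ascFrom (toℕ u) w) else ascFrom (toℕ u) w

asc-ascFrom : ∀ {k n} (w : Word k n) → asc w ≡ ascFrom 0 w
asc-ascFrom = go 0
  where
  ascent? : ∀ {n} (xs : Vec ℕ (suc n)) → Decidable (λ i → lookup xs (inject₁ i) ℕ.< lookup xs (Fin.suc i))
  ascent? xs i = lookup xs (inject₁ i) ℕP.<? lookup xs (Fin.suc i)
  ascents : ∀ {n} → Vec ℕ (suc n) → ℕ
  ascents {n} xs = length (filter (ascent? xs) (allFin n))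
  go : ∀ {k n} v (w : Word k n) → ascents (v Vec.∷ Vec.map toℕ w) ≡ ascFrom v w
  go v Vec.[] = refl
  go v (u Vec.∷ w) with does (v ℕP.<? toℕ u)
                      | length-filter-tabulate (ascent? (v Vec.∷ toℕ u Vec.∷ Vec.map toℕ w))
                          (ascent? (toℕ u Vec.∷ Vec.map toℕ w)) Fin.suc (λ i → i) (λ i → refl)
  ... | true  | eq = cong suc (trans eq (go (toℕ u) w))
  ... | false | eq = trans eq (go (toℕ u) w)

sumOver : ∀ {A : Set} → (A → ℚ) → List A → ℚ
sumOver φ = foldr (λ x s → φ x + s) 0ℚ

sumOver-map-++ : ∀ {A B : Set} (φ : B → ℚ) (f : A → B) xs ys →
                 sumOver φ (map f xs ++ ys) ≡ sumOver (φ ∘ f) xs + sumOver φ ys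
sumOver-map-++ φ f []       ys = sym (ℚP.+-identityˡ _)
sumOver-map-++ φ f (x ∷ xs) ys = trans (cong (φ (f x) +_) (sumOver-map-++ φ f xs ys))
  (sym (ℚP.+-assoc (φ (f x)) _ _))

sumOver-product : ∀ {A B C : Set} (φ : C → ℚ) (f : A → B → C) xs ys →
  sumOver φ (cartesianProductWith f xs ys) ≡ sumOver (λ x → sumOver (φ ∘ f x) ys) xs
sumOver-product φ f []       ys = refl
sumOver-product φ f (x ∷ xs) ys = trans (sumOver-map-++ φ (f x) ys _)
  (cong (sumOver (φ ∘ f x) ys +_) (sumOver-product φ f xs ys))

sumOver-zero : ∀ {A : Set} {φ : A → ℚ} → (∀ x → φ x ≡ 0ℚ) → ∀ xs → sumOver φ xs ≡ 0ℚ
sumOver-zero eq []       = refl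
sumOver-zero eq (x ∷ xs) = trans (cong₂ _+_ (eq x) (sumOver-zero eq xs)) (ℚP.+-identityˡ 0ℚ)

sumOver-tabulate : ∀ {A : Set} {φ : ℚ[X] → ℚ} → Additive φ → ∀ (ψ : A → ℚ) (f : ℕ → ℚ[X]) a {d} (h : Fin d → A) →
  (∀ u → ψ (h u) ≡ φ (f (a ℕ.+ toℕ u))) → sumOver ψ (tabulate h) ≡ φ (sumP f a d)
sumOver-tabulate         φ-add ψ f a {zero}  h eq = sym (zero-homo φ-add)
sumOver-tabulate {φ = φ} φ-add ψ f a {suc d} h eq = trans
  (cong₂ _+_ (trans (eq Fin.zero) (cong (φ ∘ f) (ℕP.+-identityʳ a)))
    (sumOver-tabulate φ-add ψ f (suc a) (h ∘ Fin.suc)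
      (λ u → trans (eq (Fin.suc u)) (cong (φ ∘ f) (ℕP.+-suc a (toℕ u))))))
  (sym (⊕-homo φ-add (f a) _))

sumP-cong : ∀ {φ ψ} → Additive φ → Additive ψ → ∀ f g a d →
  (∀ l → a ℕ.≤ l → l ℕ.< a ℕ.+ d → φ (f l) ≡ ψ (g l)) → φ (sumP f a d) ≡ ψ (sumP g a d)
sumP-cong φ-add ψ-add f g a zero    eq = trans (zero-homo φ-add) (sym (zero-homo ψ-add))
sumP-cong φ-add ψ-add f g a (suc d) eq = trans (⊕-homo φ-add (f a) _) (trans
  (cong₂ _+_ (eq a ℕP.≤-refl (ℕP.m<m+n a (s≤s z≤n)))
    (sumP-cong φ-add ψ-add f g (suc a) d
      (λ l a<l l< → eq l (ℕP.<⇒≤ a<l) (subst (l ℕ.<_) (sym (ℕP.+-suc a d)) l<))))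
  (sym (⊕-homo ψ-add (g a) _)))

coX-additive : ∀ i → Additive (λ p → co (X⊗ p) i)
coX-additive zero    = record { zero-homo = refl ; ⊕-homo = λ p q → refl }
coX-additive (suc i) = co-additive i

monomial : ℕ → ℚ[X]
monomial zero    = 1ℚ ∷ []
monomial (suc m) = X⊗ monomial m

coeff-X^ : ∀ m i N → seq (coeff (X^ m) i) N ≡ co (monomial m) i
coeff-X^ zero    zero    N = refl
coeff-X^ zero    (suc i) N = refl
coeff-X^ (suc m) zero    N = refl
coeff-X^ (suc m) (suc i) N = coeff-X^ m i N

coeff-+ᴾ : ∀ p q i N → seq (coeff (p +ᴾ q) i) N ≡ seq (coeff p i) N + seq (coeff q i) N
coeff-+ᴾ []      q       i       N = sym (ℚP.+-identityˡ _)
coeff-+ᴾ (c ∷ p) []      i       N = sym (ℚP.+-identityʳ _)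
coeff-+ᴾ (c ∷ p) (d ∷ q) zero    N = refl
coeff-+ᴾ (c ∷ p) (d ∷ q) (suc i) N = coeff-+ᴾ p q i N

-- Ascent counts and the family

module Ascents (κ : ℕ) where
  open Family κ

  count : ∀ n → ℕ → ℕ → ℚ
  count n v i = sumOver (λ w → co (monomial (ascFrom v w)) i) (words (suc κ) n)

  -- A first letter `u > v` contributes a factor x and any other letter none, so the sum over `u`
  -- splits at `v` as in the recursion of `P`.
  count-P : ∀ n v i → v ℕ.≤ κ → count n v i ≡ co (P (suc n) v) i
  count-P zero v i v≤κ = sym (begin
    co (P 1 v) i
      ≡⟨ co-⊕ (sumP (P 0) 0 (suc v)) _ i ⟩
    co (sumP (P 0) 0 (suc v)) i + co (X⊗ sumP (P 0) (suc v) (κ ∸ v)) i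
      ≡⟨ cong₂ _+_ (sum-P₀-head (co-additive i) v) (sum-P₀-tail (coX-additive i) v (κ ∸ v)) ⟩
    co (1ℚ ∷ []) i + 0ℚ ∎)
    where open ≡-Reasoning
  count-P (suc n) v i v≤κ = begin
    count (suc n) v i
      ≡⟨ sumOver-product (λ w → co (monomial (ascFrom v w)) i) Vec._∷_ (allFin (suc κ)) (words (suc κ) n) ⟩
    sumOver (λ u → sumOver (λ w → co (monomial (ascFrom v (u Vec.∷ w))) i) (words (suc κ) n)) (allFin (suc κ))
      ≡⟨ sumOver-tabulate (co-additive i) (λ u → sumOver (λ w → co (monomial (ascFrom v (u Vec.∷ w))) i) (words (suc κ) n)) Q 0 (λ u → u) first-letter ⟩
    co (sumP Q 0 (suc κ)) i
      ≡⟨ cong (λ d → co (sumP Q 0 (suc d)) i) (sym (ℕP.m+[n∸m]≡n v≤κ)) ⟩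
    co (sumP Q 0 (suc v ℕ.+ (κ ∸ v))) i
      ≡⟨ sumP-split (co-additive i) Q 0 (suc v) (κ ∸ v) ⟩
    co (sumP Q 0 (suc v)) i + co (sumP Q (suc v) (κ ∸ v)) i
      ≡⟨ cong₂ _+_
           (sumP-cong (co-additive i) (co-additive i) Q (P (suc n)) 0 (suc v)
             λ l _ l≤v → cong (λ b → co (if b then X⊗ P (suc n) l else P (suc n) l) i)
               (dec-false (v ℕP.<? l) (ℕP.≤⇒≯ (ℕ.s≤s⁻¹ l≤v))))
           (sumP-cong (co-additive i) (coX-additive i) Q (P (suc n)) (suc v) (κ ∸ v)
             λ l v<l _ → cong (λ b → co (if b then X⊗ P (suc n) l else P (suc n) l) i) (dec-true (v ℕP.<? l) v<l)) ⟩
    co (sumP (P (suc n)) 0 (suc v)) i + co (X⊗ sumP (P (suc n)) (suc v) (κ ∸ v)) i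
      ≡⟨ sym (co-⊕ (sumP (P (suc n)) 0 (suc v)) _ i) ⟩
    co (P (suc (suc n)) v) i ∎
    where
    open ≡-Reasoning
    Q : ℕ → ℚ[X]
    Q u = if does (v ℕP.<? u) then X⊗ P (suc n) u else P (suc n) u
    shifted : ∀ u i → toℕ {suc κ} u ℕ.≤ κ →
      sumOver (λ w → co (X⊗ monomial (ascFrom (toℕ u) w)) i) (words (suc κ) n) ≡ co (X⊗ P (suc n) (toℕ u)) i
    shifted u zero    u≤κ = sumOver-zero (λ w → refl) (words (suc κ) n)
    shifted u (suc i) u≤κ = count-P n (toℕ u) i u≤κ
    first-letter : ∀ u → sumOver (λ w → co (monomial (ascFrom v (u Vec.∷ w))) i) (words (suc κ) n) ≡ co (Q (toℕ u)) i
    first-letter u with does (v ℕP.<? toℕ u)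
    ... | true  = shifted u i (ℕ.s≤s⁻¹ (toℕ<n u))
    ... | false = count-P n (toℕ u) i (ℕ.s≤s⁻¹ (toℕ<n u))

  -- The coefficients are sums of `0ᴿ` and `1ᴿ`, so their sequences are constant and the equation
  -- holds at every index.
  coeff-𝒜 : ∀ n i N → seq (coeff (𝒜 n (suc κ)) i) N ≡ co (P (suc n) 0) i
  coeff-𝒜 n i N = trans (go (words (suc κ) n)) (count-P n 0 i z≤n)
    where
    go : ∀ ws → seq (coeff (foldr (λ w p → X^ (asc w) +ᴾ p) 0ᴾ ws) i) N ≡ sumOver (λ w → co (monomial (ascFrom 0 w)) i) ws
    go []       = refl
    go (w ∷ ws) = trans (coeff-+ᴾ (X^ (asc w)) _ i N)
      (cong₂ _+_ (trans (coeff-X^ (asc w) i N) (cong (λ m → co (monomial m) i) (asc-ascFrom w))) (go ws))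

-- Sequences of rationals

infix 4 _≋_

-- x ≈ y unfolds to a statement about seq x and seq y; wrapping it in a record keeps the
-- sequences inferable and the Cauchy proofs out of unification problems.
record _≋_ (s t : ℕ → ℚ) : Set where
  constructor close
  field
    closeness : ∀ ε → 0ℚ ℚ.< ε → Σ ℕ λ N → ∀ n → N ℕ.≤ n → ∣ s n - t n ∣ ℚ.≤ ε
open _≋_

⊔-≤ˡ : ∀ {l m n} → l ℕ.⊔ m ℕ.≤ n → l ℕ.≤ n
⊔-≤ˡ {l} {m} = ℕP.≤-trans (ℕP.m≤m⊔n l m)

⊔-≤ʳ : ∀ l {m n} → l ℕ.⊔ m ℕ.≤ n → m ℕ.≤ n
⊔-≤ʳ l {m} = ℕP.≤-trans (ℕP.m≤n⊔m l m)

≋-pointwise : ∀ {s t : ℕ → ℚ} → (∀ n → s n ≡ t n) → s ≋ t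
≋-pointwise {s} eq = close λ ε 0<ε → 0 , λ n _ → subst (λ v → ∣ s n - v ∣ ℚ.≤ ε) (eq n)
  (subst (ℚ._≤ ε) (sym (cong ∣_∣ (ℚP.+-inverseʳ (s n)))) (ℚP.<⇒≤ 0<ε))

≋-sym : ∀ {s t} → s ≋ t → t ≋ s
≋-sym {s} {t} s≋t = close λ ε 0<ε → let N , near = closeness s≋t ε 0<ε in N , λ n N≤n →
  subst (ℚ._≤ ε) (trans (sym (ℚP.∣-p∣≡∣p∣ (s n - t n)))
    (cong ∣_∣ (solve 2 (λ x y → :- (x :- y) := y :- x) refl (s n) (t n)))) (near n N≤n)

≋-+ : ∀ {s s′ t t′} → s ≋ s′ → t ≋ t′ → (λ n → s n + t n) ≋ (λ n → s′ n + t′ n)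
≋-+ {s} {s′} {t} {t′} s≋ t≋ = close λ ε 0<ε →
  let M , nearˢ = closeness s≋ (½ * ε) (0<½* 0<ε)
      N , nearᵗ = closeness t≋ (½ * ε) (0<½* 0<ε)
  in M ℕ.⊔ N , λ n ≤n → subst₂ ℚ._≤_
    (cong ∣_∣ (solve 4 (λ x x′ y y′ → (x :- x′) :+ (y :- y′) := (x :+ y) :- (x′ :+ y′)) refl (s n) (s′ n) (t n) (t′ n)))
    (½+½ ε)
    (∣+∣≤ (s n - s′ n) (t n - t′ n) (nearˢ n (⊔-≤ˡ ≤n)) (nearᵗ n (⊔-≤ʳ M ≤n)))

≋-trans : ∀ {s t u} → s ≋ t → t ≋ u → s ≋ u
≋-trans {s} {t} {u} s≋t t≋u = close λ ε 0<ε → let N , near = closeness (≋-+ s≋t t≋u) ε 0<ε in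
  N , λ n N≤n → subst (λ v → ∣ v ∣ ℚ.≤ ε)
    (solve 3 (λ x y z → (x :+ y) :- (y :+ z) := x :- z) refl (s n) (t n) (u n)) (near n N≤n)

eventually-bounded : ∀ x → Σ ℚ λ B → 0ℚ ℚ.< B × Σ ℕ λ N → ∀ n → N ℕ.≤ n → ∣ seq x n ∣ ℚ.≤ B
eventually-bounded x with cauchy x 1ℚ 0<1
... | N , near = 1ℚ + ∣ seq x N ∣ , 0<+ 0<1 (ℚP.0≤∣p∣ (seq x N)) , N , λ n N≤n →
  subst (λ v → ∣ v ∣ ℚ.≤ 1ℚ + ∣ seq x N ∣) (solve 2 (λ a b → (a :- b) :+ b := a) refl (seq x n) (seq x N))
    (∣+∣≤ (seq x n - seq x N) (seq x N) (near n N N≤n ℕP.≤-refl) ℚP.≤-refl)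

≋-* : ∀ {t t′} x → t ≋ t′ → (λ n → seq x n * t n) ≋ (λ n → seq x n * t′ n)
≋-* {t} {t′} x t≋ = close λ ε 0<ε →
  let B , 0<B , M , bound = eventually-bounded x
      δ , 0<δ , Bδ≡ε = divide B 0<B ε 0<ε
      N , near = closeness t≋ δ 0<δ
  in M ℕ.⊔ N , λ n ≤n → subst₂ ℚ._≤_
    (cong ∣_∣ (solve 3 (λ x y z → x :* (y :- z) := x :* y :- x :* z) refl (seq x n) (t n) (t′ n)))
    Bδ≡ε
    (∣*∣≤ (seq x n) (t n - t′ n) (bound n (⊔-≤ˡ ≤n)) (near n (⊔-≤ʳ M ≤n)))

apart : ∀ {x y} → x # y → Σ ℚ λ η → 0ℚ ℚ.< η × Σ ℕ λ N → ∀ n → N ℕ.≤ n → η ℚ.≤ ∣ seq y n - seq x n ∣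
apart {x} {y} (inj₁ (η , 0<η , N , h)) = η , 0<η , N , λ n N≤n → ℚP.≤-trans
  (≤-from-slack (p≤q⇒0≤q-p (h n N≤n)) (solve 3 (λ η x y → η :+ (y :- (x :+ η)) := y :- x) refl η (seq x n) (seq y n)))
  (p≤∣p∣ (seq y n - seq x n))
apart {x} {y} (inj₂ (η , 0<η , N , h)) = η , 0<η , N , λ n N≤n → ℚP.≤-trans
  (≤-from-slack (p≤q⇒0≤q-p (h n N≤n)) (solve 3 (λ η x y → η :+ (x :- (y :+ η)) := :- (y :- x)) refl η (seq x n) (seq y n)))
  (-p≤∣p∣ (seq y n - seq x n))

-- Apartness keeps `∣ y - x ∣` eventually above some `η > 0`, by which the estimate is divided.
≋-cancel : ∀ {t x y} → x # y → (λ n → (seq y n - seq x n) * t n) ≋ (λ _ → 0ℚ) → t ≋ (λ _ → 0ℚ)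
≋-cancel {t} {x} {y} x#y xt≋0 = close λ ε 0<ε →
  let η , 0<η , M , far = apart {x} {y} x#y
      N , near = closeness xt≋0 (η * ε) (0<* 0<η 0<ε)
  in M ℕ.⊔ N , λ n ≤n → subst (λ v → ∣ v ∣ ℚ.≤ ε) (sym (ℚP.+-identityʳ (t n)))
    (ℚP.*-cancelˡ-≤-pos η {{ℚ.positive 0<η}} (ℚP.≤-trans
      (*-mono-≤ (ℚP.<⇒≤ 0<η) (ℚP.0≤∣p∣ (t n)) (far n (⊔-≤ˡ ≤n)) ℚP.≤-refl)
      (subst (ℚ._≤ η * ε)
        (trans (cong ∣_∣ (ℚP.+-identityʳ ((seq y n - seq x n) * t n))) (ℚP.∣p*q∣≡∣p∣*∣q∣ (seq y n - seq x n) (t n)))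
        (near n (⊔-≤ʳ M ≤n)))))

-- Division by X - r

-- Horner's scheme: the values at `r` of the proper tails of `p` are the coefficients of the
-- quotient, and `ev p r` is the remainder.
quotient : ℚ → ℚ[X] → ℚ[X]
quotient r []      = []
quotient r (c ∷ p) = ev p r ∷ quotient r p

ev-quotient : ∀ r p x → ev p x ≡ (x - r) * ev (quotient r p) x + ev p r
ev-quotient r []      x = solve 1 (λ d → con 0ℚ := d :* con 0ℚ :+ con 0ℚ) refl (x - r)
ev-quotient r (c ∷ p) x = trans (cong (λ t → c + x * t) (ev-quotient r p x))
  (solve 5 (λ c x r q e → c :+ x :* ((x :- r) :* q :+ e) := (x :- r) :* (e :+ x :* q) :+ (c :+ r :* e)) refl
    c x r (ev (quotient r p) x) (ev p r))

co-quotient-0 : ∀ r p → co p 0 ≡ ev p r + (- r) * co (quotient r p) 0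
co-quotient-0 r []      = solve 1 (λ r → con 0ℚ := con 0ℚ :+ (:- r) :* con 0ℚ) refl r
co-quotient-0 r (c ∷ p) = solve 3 (λ c r e → c := (c :+ r :* e) :+ (:- r) :* e) refl c r (ev p r)

co-quotient-suc : ∀ r p i → co p (suc i) ≡ co (quotient r p) i + (- r) * co (quotient r p) (suc i)
co-quotient-suc r []      i       = solve 1 (λ r → con 0ℚ := con 0ℚ :+ (:- r) :* con 0ℚ) refl r
co-quotient-suc r (c ∷ p) zero    = co-quotient-0 r p
co-quotient-suc r (c ∷ p) (suc i) = co-quotient-suc r p i

-- Vanishing is stated from an index on, so that `d = 0` covers the zero quotient of a constant.
quotient-degree : ∀ r d p → (∀ i → suc d ℕ.≤ i → co p i ≡ 0ℚ) → ∀ i → d ℕ.≤ i → co (quotient r p) i ≡ 0ℚ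
quotient-degree r d       []      v i       _         = refl
quotient-degree r zero    (c ∷ p) v zero    _         = co≡0⇒ev≡0 p r (λ i → v (suc i) (s≤s z≤n))
quotient-degree r zero    (c ∷ p) v (suc i) _         = quotient-degree r 0 p (λ j _ → v (suc j) (s≤s z≤n)) i z≤n
quotient-degree r (suc d) (c ∷ p) v (suc i) (s≤s d≤i) = quotient-degree r d p (λ j d<j → v (suc j) (s≤s d<j)) i d≤i

co-quotient-lead : ∀ r d p → (∀ i → suc (suc d) ℕ.≤ i → co p i ≡ 0ℚ) → co (quotient r p) d ≡ co p (suc d)
co-quotient-lead r d p v = sym (trans (co-quotient-suc r p d)
  (trans (cong (λ t → co (quotient r p) d + (- r) * t) (quotient-degree r (suc d) p v (suc d) ℕP.≤-refl))
    (solve 2 (λ a r → a :+ (:- r) :* con 0ℚ := a) refl (co (quotient r p) d) r)))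

coeff-·ᴾ : ∀ c p i N → seq (coeff (c ·ᴾ p) i) N ≡ seq c N * seq (coeff p i) N
coeff-·ᴾ c []      i       N = sym (ℚP.*-zeroʳ (seq c N))
coeff-·ᴾ c (d ∷ p) zero    N = refl
coeff-·ᴾ c (d ∷ p) (suc i) N = coeff-·ᴾ c p i N

module _ (c : ℝ) (q : ℝ[X]) (N : ℕ) where

  coeff-linear-0 : seq (coeff ((c ∷ 1ᴿ ∷ []) *ᴾ q) 0) N ≡ seq c N * seq (coeff q 0) N
  coeff-linear-0 = trans (coeff-+ᴾ (c ·ᴾ q) _ 0 N)
    (trans (cong (_+ 0ℚ) (coeff-·ᴾ c q 0 N)) (ℚP.+-identityʳ _))

  coeff-linear-suc : ∀ i → seq (coeff ((c ∷ 1ᴿ ∷ []) *ᴾ q) (suc i)) N ≡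
    seq c N * seq (coeff q (suc i)) N + seq (coeff q i) N
  coeff-linear-suc i = trans (coeff-+ᴾ (c ·ᴾ q) _ (suc i) N)
    (cong₂ _+_ (coeff-·ᴾ c q (suc i) N)
      (trans (coeff-+ᴾ (1ᴿ ·ᴾ q) (0ᴿ ∷ []) i N)
        (trans (cong₂ _+_ (trans (coeff-·ᴾ 1ᴿ q i N) (ℚP.*-identityˡ (seq (coeff q i) N))) (zero-coeff i)) (ℚP.+-identityʳ _))))
    where
    zero-coeff : ∀ i → seq (coeff (0ᴿ ∷ []) i) N ≡ 0ℚ
    zero-coeff zero    = refl
    zero-coeff (suc i) = refl

-- The polynomials p n approximate the successive quotients of a rational polynomial by its
-- linear factors X - r; r is known at stage n only through seq r n.
factor : ∀ (rs : List ℝ) (p : ℕ → ℚ[X]) c → (∀ n → DegreeAtMostℚ (length rs) (p n)) →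
  (∀ n → co (p n) (length rs) ≡ c) → AllPairs _#_ rs → All (λ r → (λ n → ev (p n) (seq r n)) ≋ (λ _ → 0ℚ)) rs →
  ∀ i → (λ n → co (p n) i) ≋ (λ n → c * seq (coeff ∏[X- rs ] i) n)
factor [] p c deg lead _ _ zero    = ≋-pointwise (λ n → trans (lead n) (sym (ℚP.*-identityʳ c)))
factor [] p c deg lead _ _ (suc i) = ≋-pointwise (λ n → trans (deg n (suc i) (s≤s z≤n)) (sym (ℚP.*-zeroʳ c)))
factor (r ∷ rs) p c deg lead (r#rs ∷ rs#) (r-root ∷ rs-roots) = result
  where
  q : ℕ → ℚ[X]
  q n = quotient (seq r n) (p n)
  π : ℕ → ℕ → ℚ
  π i n = seq (coeff ∏[X- rs ] i) n
  -- Here `(s - r) q(s) = p(s) - p(r)` tends to 0, while `s` is apart from `r`.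
  q-root : ∀ {s} → r # s → (λ n → ev (p n) (seq s n)) ≋ (λ _ → 0ℚ) → (λ n → ev (q n) (seq s n)) ≋ (λ _ → 0ℚ)
  q-root {s} r#s s-root = ≋-cancel {x = r} {y = s} r#s (≋-trans
    (≋-pointwise λ n → trans (solve 2 (λ a b → a := (a :+ b) :+ (:- con 1ℚ) :* b) refl
        ((seq s n - seq r n) * ev (q n) (seq s n)) (ev (p n) (seq r n)))
      (cong (λ v → v + (- 1ℚ) * ev (p n) (seq r n)) (sym (ev-quotient (seq r n) (p n) (seq s n)))))
    (≋-+ s-root (≋-* (fromℚ (- 1ℚ)) r-root)))
  q-factored : ∀ i → (λ n → co (q n) i) ≋ (λ n → c * π i n)
  q-factored = factor rs q c (λ n → quotient-degree (seq r n) _ (p n) (deg n))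
    (λ n → trans (co-quotient-lead (seq r n) _ (p n) (deg n)) (lead n))
    rs# (All.zipWith (λ {s} (a , b) → q-root {s} a b) (r#rs , rs-roots))
  result : ∀ i → (λ n → co (p n) i) ≋ (λ n → c * seq (coeff ∏[X- r ∷ rs ] i) n)
  -- The remainder `p(r)` enters the constant coefficient only, and it tends to 0.
  result zero = ≋-trans (≋-pointwise λ n → co-quotient-0 (seq r n) (p n))
    (≋-trans (≋-+ r-root (≋-* (-ᴿ r) (q-factored 0)))
      (≋-pointwise λ n → sym (trans (cong (c *_) (coeff-linear-0 (-ᴿ r) ∏[X- rs ] n))
        (solve 3 (λ c r a → c :* ((:- r) :* a) := con 0ℚ :+ (:- r) :* (c :* a)) refl c (seq r n) (π 0 n)))))
  result (suc i) = ≋-trans (≋-pointwise λ n → co-quotient-suc (seq r n) (p n) i)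
    (≋-trans (≋-+ (q-factored i) (≋-* (-ᴿ r) (q-factored (suc i))))
      (≋-pointwise λ n → sym (trans (cong (c *_) (coeff-linear-suc (-ᴿ r) ∏[X- rs ] n i))
        (solve 4 (λ c r a b → c :* ((:- r) :* b :+ a) := c :* a :+ (:- r) :* (c :* b)) refl c (seq r n) (π i n) (π (suc i) n)))))

-- Real roots as limits of bisections

IsRoot : ℚ[X] → ℝ → Set
IsRoot f x = (λ n → ev f (seq x n)) ≋ (λ _ → 0ℚ)

-- The bounds hold at every index of the sequence, so neighbouring reals are compared through
-- rationals.
record Located (l u : ℚ) (x : ℝ) : Set where
  field
    lower : ∀ n → l ℚ.≤ seq x n
    upper : ∀ n → seq x n ℚ.≤ u
open Located

module _ (f : ℚ[X]) (b : Bracket (ev f)) where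
  open Bracket

  private
    b# : ℕ → Bracket (ev f)
    b# = bisect b

    los-close : ∀ {N m n} → N ℕ.≤ m → N ℕ.≤ n → lo (b# m) - lo (b# n) ℚ.≤ width (b# N)
    los-close {N} {m} {n} N≤m N≤n = ℚP.+-mono-≤
      (ℚP.≤-trans (ℚP.<⇒≤ (lo<hi (b# m))) (proj₂ (bisect-nested b N≤m)))
      (ℚP.neg-antimono-≤ (proj₁ (bisect-nested b N≤n)))

  bisection-limit : ℝ
  bisection-limit .seq n = lo (b# n)
  bisection-limit .cauchy ε 0<ε = let N , narrow = bisect-narrow b ε 0<ε in N , λ m n N≤m N≤n →
    ∣p∣≤q (ℚP.≤-trans (los-close N≤m N≤n) narrow)
      (subst (ℚ._≤ ε) (solve 2 (λ x y → x :- y := :- (y :- x)) refl (lo (b# n)) (lo (b# m)))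
        (ℚP.≤-trans (los-close N≤n N≤m) narrow))

  bisection-limit-located : Located (lo b) (hi b) bisection-limit
  bisection-limit-located .lower n = proj₁ (bisect-nested b {n = n} z≤n)
  bisection-limit-located .upper n =
    ℚP.≤-trans (ℚP.<⇒≤ (lo<hi (b# n))) (proj₂ (bisect-nested b {n = n} z≤n))

  -- As f is nonpositive at `lo` and nonnegative at `hi`, its size at `lo` is at most its rise over
  -- the bracket, which is at most the width times a bound for `Δ`.
  bisection-limit-root : IsRoot f bisection-limit
  bisection-limit-root = close λ ε 0<ε →
    let δ , 0<δ , Kδ≡ε = divide K (0<+ 0<1 0≤C) ε 0<ε
        N , narrow = bisect-narrow b δ 0<δ
    in N , λ n N≤n → subst₂ ℚ._≤_ (cong ∣_∣ (sym (ℚP.+-identityʳ _))) Kδ≡ε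
      (ℚP.≤-trans (value-bound n) (*-mono-≤ (ℚP.<⇒≤ (0<+ 0<1 0≤C)) (ℚP.<⇒≤ (0<width (b# n))) ℚP.≤-refl
        (ℚP.≤-trans (ℚP.+-mono-≤ (proj₂ (bisect-nested b N≤n)) (ℚP.neg-antimono-≤ (proj₁ (bisect-nested b N≤n)))) narrow)))
    where
    R = ∣ lo b ∣ + ∣ hi b ∣
    C = ΔBound R f
    K = 1ℚ + C
    loR : ∀ n → ∣ lo (b# n) ∣ ℚ.≤ R
    loR n = ∣∣-between (lower bisection-limit-located n) (upper bisection-limit-located n)
    hiR : ∀ n → ∣ hi (b# n) ∣ ℚ.≤ R
    hiR n = ∣∣-between (ℚP.≤-trans (lower bisection-limit-located n) (ℚP.<⇒≤ (lo<hi (b# n)))) (proj₂ (bisect-nested b {n = n} z≤n))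
    0≤C : 0ℚ ℚ.≤ C
    0≤C = ℚP.≤-trans (ℚP.0≤∣p∣ _) (∣Δ∣≤ R f (loR 0) (loR 0))
    value-bound : ∀ n → ∣ ev f (lo (b# n)) ∣ ℚ.≤ K * width (b# n)
    value-bound n = begin
      ∣ ev f (lo (b# n)) ∣
        ≡⟨ trans (sym (ℚP.∣-p∣≡∣p∣ _)) (ℚP.0≤p⇒∣p∣≡p (ℚP.neg-antimono-≤ (f-lo (b# n)))) ⟩
      - ev f (lo (b# n))
        ≤⟨ ≤-from-slack (f-hi (b# n)) (ℚP.+-comm (- ev f (lo (b# n))) _) ⟩
      ev f (hi (b# n)) - ev f (lo (b# n))
        ≡⟨ ev-Δ f (hi (b# n)) (lo (b# n)) ⟩
      width (b# n) * Δ f (hi (b# n)) (lo (b# n))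
        ≤⟨ *-monoʳ-nonNeg (p≤∣p∣ _) ⟩
      width (b# n) * ∣ Δ f (hi (b# n)) (lo (b# n)) ∣
        ≤⟨ *-monoʳ-nonNeg (∣Δ∣≤ R f (hiR n) (loR n)) ⟩
      width (b# n) * C
        ≤⟨ ≤-from-slack (ℚP.<⇒≤ (0<width (b# n))) (solve 2 (λ w C → w :* C :+ w := (con 1ℚ :+ C) :* w) refl (width (b# n)) C) ⟩
      K * width (b# n) ∎
      where
      open ℚP.≤-Reasoning
      *-monoʳ-nonNeg : ∀ {p q} → p ℚ.≤ q → width (b# n) * p ℚ.≤ width (b# n) * q
      *-monoʳ-nonNeg = ℚP.*-monoˡ-≤-nonNeg (width (b# n)) {{ℚ.nonNegative (ℚP.<⇒≤ (0<width (b# n)))}}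

root-between : ∀ f ε {l u} → ε * ε ≡ 1ℚ → l ℚ.< u → ε * ev f l ℚ.≤ 0ℚ → 0ℚ ℚ.≤ ε * ev f u →
               Σ ℝ λ x → Located l u x × IsRoot f x
root-between f ε {l} {u} ε²≡1 l<u fl≤0 0≤fu =
  bisection-limit (ε ⊙ f) b , bisection-limit-located (ε ⊙ f) b ,
  ≋-trans (≋-pointwise λ n → sym (undo (seq (bisection-limit (ε ⊙ f) b) n)))
    (≋-trans (≋-* (fromℚ ε) (bisection-limit-root (ε ⊙ f) b)) (≋-pointwise λ _ → ℚP.*-zeroʳ ε))
  where
  b : Bracket (ev (ε ⊙ f))
  b = record { lo<hi = l<u ; f-lo = subst (ℚ._≤ 0ℚ) (sym (ev-⊙ ε f l)) fl≤0 ; f-hi = subst (0ℚ ℚ.≤_) (sym (ev-⊙ ε f u)) 0≤fu }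
  undo : ∀ x → ε * ev (ε ⊙ f) x ≡ ev f x
  undo x = trans (cong (ε *_) (ev-⊙ ε f x)) (trans (sym (ℚP.*-assoc ε ε (ev f x)))
    (trans (cong (_* ev f x) ε²≡1) (ℚP.*-identityˡ (ev f x))))

-- Descending lists of reals, separated by rationals

data Descending : ℚ → List ℝ → Set where
  []   : ∀ {t} → Descending t []
  cons : ∀ {t l u x xs} → u ℚ.≤ t → Located l u x → Descending l xs → Descending t (x ∷ xs)

data StrictlyDescending : ℚ → List ℝ → Set where
  []   : ∀ {t} → StrictlyDescending t []
  cons : ∀ {t l u x xs} → u ℚ.< t → Located l u x → StrictlyDescending l xs → StrictlyDescending t (x ∷ xs)

strictly⇒descending : ∀ {t xs} → StrictlyDescending t xs → Descending t xs
strictly⇒descending []               = []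
strictly⇒descending (cons u<t x∈ ds) = cons (ℚP.<⇒≤ u<t) x∈ (strictly⇒descending ds)

descending⇒linked : ∀ {t xs} → Descending t xs → Linked _≥_ xs
descending⇒linked []                                    = []
descending⇒linked (cons _ _ [])                         = [-]
descending⇒linked (cons _ x∈ ds@(cons u′≤l y∈ _)) =
  (λ ε 0<ε → 0 , λ n _ → ℚP.≤-trans (upper y∈ n) (ℚP.≤-trans u′≤l (ℚP.≤-trans (lower x∈ n)
    (≤-from-slack (ℚP.<⇒≤ 0<ε) refl)))) ∷ descending⇒linked ds

strictly⇒apart : ∀ {t xs} → StrictlyDescending t xs → AllPairs _#_ xs
strictly⇒apart []                     = []
strictly⇒apart (cons {l = l} {x = x} _ x∈ ds) = All.map (λ {y} → separate {y}) (below ds) ∷ strictly⇒apart ds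
  where
  Below : ℚ → ℝ → Set
  Below t y = Σ ℚ λ u → u ℚ.< t × ∀ n → seq y n ℚ.≤ u
  below : ∀ {t ys} → StrictlyDescending t ys → All (Below t) ys
  below []                          = []
  below (cons {l = l′} u<t y∈ ds)   = (_ , u<t , upper y∈) ∷ All.map (λ (u′ , u′<l , ≤u′) →
    u′ , ℚP.<-trans u′<l (ℚP.≤-<-trans (ℚP.≤-trans (lower y∈ 0) (upper y∈ 0)) u<t) , ≤u′) (below ds)
  separate : ∀ {y} → Below l y → x # y
  separate {y} (u , u<l , ≤u) = inj₂ (l - u , p<q⇒0<q-p u<l , 0 , λ n _ → ℚP.≤-trans
    (ℚP.+-monoˡ-≤ (l - u) (≤u n))
    (subst (ℚ._≤ seq x n) (solve 2 (λ u l → l := u :+ (l :- u)) refl u l) (lower x∈ n)))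

-- For the case in which the ascent polynomial is its own reversal.
alternate-self : ∀ {xs} → Linked _≥_ xs → Linked _≥_ (alternate xs xs)
alternate-self []          = []
alternate-self [-]         = (λ ε 0<ε → 0 , λ n _ → ≤-from-slack (ℚP.<⇒≤ 0<ε) refl) ∷ [-]
alternate-self (x≥y ∷ l) = (λ ε 0<ε → 0 , λ n _ → ≤-from-slack (ℚP.<⇒≤ 0<ε) refl) ∷ x≥y ∷ alternate-self l

-- `same` tells whether g has as many zeros as f or one fewer. The first zero of f may equal `top`,
-- so the list is strictly below larger rationals only; the zeros of g stay strictly below `top`.
record Zeros (f g : ℚ[X]) (same : Bool) (top : ℚ) (d : ℕ) : Set where
  field
    xs ys      : List ℝ
    xs-length  : length xs ≡ suc d
    ys-length  : length ys ≡ (if same then suc d else d)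
    interlaced : Descending top (alternate xs ys)
    xs-desc    : ∀ {t} → top ℚ.< t → StrictlyDescending t xs
    ys-desc    : StrictlyDescending top ys
    xs-roots   : All (IsRoot f) xs
    ys-roots   : All (IsRoot g) ys

-- Each isolating interval holds a zero of f. As g changes sign between the lower end of one
-- interval and the upper end of the next, it has a zero there; if `same` holds, a last one lies
-- below all intervals.
find-zeros : ∀ {f g} same {ε lo hi d} → ε * ε ≡ 1ℚ → lo ℚ.< hi → ε * ev f lo ℚ.≤ 0ℚ → 0ℚ ℚ.≤ ε * ev f hi →
             0ℚ ℚ.< ε * ev g lo → Isolates f g (- ε) lo d → (T same → HasSignBelow g (sgn ε (suc d))) →
             Zeros f g same hi d
find-zeros {f} {g} false {ε} ε²≡1 lo<hi f-lo f-hi g-lo [] _ =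
  let x , x∈ , x-root = root-between f ε ε²≡1 lo<hi f-lo f-hi in record
    { xs = x ∷ [] ; ys = [] ; xs-length = refl ; ys-length = refl
    ; interlaced = cons ℚP.≤-refl x∈ []
    ; xs-desc = λ hi<t → cons hi<t x∈ [] ; ys-desc = []
    ; xs-roots = x-root ∷ [] ; ys-roots = [] }
find-zeros {f} {g} true {ε} {lo} ε²≡1 lo<hi f-lo f-hi g-lo [] below =
  let x , x∈ , x-root = root-between f ε ε²≡1 lo<hi f-lo f-hi
      s , s<lo , 0<-gs = below tt lo
      y , y∈ , y-root = root-between g ε ε²≡1 s<lo (nonpos ε (ev g s) 0<-gs) (ℚP.<⇒≤ g-lo)
  in record
    { xs = x ∷ [] ; ys = y ∷ [] ; xs-length = refl ; ys-length = refl
    ; interlaced = cons ℚP.≤-refl x∈ (cons ℚP.≤-refl y∈ [])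
    ; xs-desc = λ hi<t → cons hi<t x∈ [] ; ys-desc = cons lo<hi y∈ []
    ; xs-roots = x-root ∷ [] ; ys-roots = y-root ∷ [] }
find-zeros {f} {g} same {ε} {lo} {hi} ε²≡1 lo<hi f-lo f-hi g-lo
  (cons {hi = hi′} hi′≤lo lo′<hi′ f-lo′ f-hi′ g-lo′ g-hi′ rest) below =
  let x , x∈ , x-root = root-between f ε ε²≡1 lo<hi f-lo f-hi
      y , y∈ , y-root = root-between g ε ε²≡1 hi′<lo (nonpos ε (ev g hi′) g-hi′) (ℚP.<⇒≤ g-lo)
      z = find-zeros same (-ε*-ε ε ε²≡1) lo′<hi′ f-lo′ f-hi′ g-lo′ rest below
  in record
    { xs = x ∷ Zeros.xs z ; ys = y ∷ Zeros.ys z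
    ; xs-length = cong suc (Zeros.xs-length z)
    ; ys-length = trans (cong suc (Zeros.ys-length z)) (count same)
    ; interlaced = cons ℚP.≤-refl x∈ (cons ℚP.≤-refl y∈ (Zeros.interlaced z))
    ; xs-desc = λ hi<t → cons hi<t x∈ (Zeros.xs-desc z hi′<lo)
    ; ys-desc = cons lo<hi y∈ (Zeros.ys-desc z)
    ; xs-roots = x-root ∷ Zeros.xs-roots z ; ys-roots = y-root ∷ Zeros.ys-roots z }
  where
  count : ∀ same {d} → suc (if same then suc d else d) ≡ (if same then suc (suc d) else suc d)
  count true  = refl
  count false = refl
  -- Touching intervals would give g both signs at the common end. The strict gap is what makes the
  -- zeros of f apart.
  hi′<lo : hi′ ℚ.< lo
  hi′<lo with hi′ ℚP.<? lo
  ... | yes h = h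
  ... | no  h = contradiction
    (ℚP.<-≤-trans g-lo (subst (λ v → ε * ev g v ℚ.≤ 0ℚ) (ℚP.≤-antisym hi′≤lo (ℚP.≮⇒≥ h)) (nonpos ε (ev g hi′) g-hi′)))
    (ℚP.<-irrefl refl)

-- Real-rootedness

Represents : ℝ[X] → ℚ[X] → Set
Represents h f = ∀ i → seq (coeff h i) ≋ (λ _ → co f i)

0<fromℚ : ∀ {c} → 0ℚ ℚ.< c → 0ᴿ < fromℚ c
0<fromℚ {c} 0<c = c , 0<c , 0 , λ _ _ → ℚP.≤-reflexive (ℚP.+-identityˡ c)

realRooted : ∀ f {h xs t} → Represents h f → DegreeAtMostℚ (length xs) f → 0ℚ ℚ.< co f (length xs) →
             StrictlyDescending t xs → All (IsRoot f) xs → RealRooted h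
realRooted f {h} {xs} h≋f deg 0<lead desc roots = record
  { leading    = fromℚ c
  ; leading#0  = inj₂ (0<fromℚ 0<lead)
  ; zeros      = xs
  ; decreasing = descending⇒linked (strictly⇒descending desc)
  ; factored   = λ i → closeness (≋-trans (h≋f i) (≋-trans
      (factor xs (λ _ → f) c (λ _ → deg) (λ _ → refl) (strictly⇒apart desc) roots i)
      (≋-pointwise λ n → sym (coeff-·ᴾ (fromℚ c) ∏[X- xs ] i n))))
  }
  where c = co f (length xs)

module _ {f g : ℚ[X]} {d : ℕ} (W≥1 : ∀ x → 1ℚ ℚ.≤ W g f x) (alt : Alternates f 1ℚ 0ℚ (suc d))
         (f-deg : DegreeAtMostℚ (suc d) f) (0<f-lead : 0ℚ ℚ.< co f (suc d)) where

  private
    zeros-of : ∀ same → (T same → HasSignBelow g (sgn 1ℚ (suc d))) → Σ ℚ λ top → Zeros f g same top d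
    zeros-of same below with isolate {f} {g} W≥1 refl alt
    ... | cons {hi = hi} _ lo<hi f-lo f-hi g-lo _ rest = hi , find-zeros same refl lo<hi f-lo f-hi g-lo rest below

    f-realRooted : ∀ {same top h} (z : Zeros f g same top d) → Represents h f → RealRooted h
    f-realRooted {top = top} {h} z h≋f = realRooted f {h} h≋f
      (subst (λ m → DegreeAtMostℚ m f) (sym (Zeros.xs-length z)) f-deg)
      (subst (λ m → 0ℚ ℚ.< co f m) (sym (Zeros.xs-length z)) 0<f-lead)
      (Zeros.xs-desc z (<-from-slack 0<1 (refl {x = top + 1ℚ}))) (Zeros.xs-roots z)

  -- Here g is an auxiliary partner that isolates the zeros of f; its own zeros are discarded.
  realRooted-of-W : ∀ {h} → Represents h f → RealRooted h
  realRooted-of-W {h} = f-realRooted {h = h} (proj₂ (zeros-of false λ ()))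

  self-≪-of-W : ∀ {h h′} → Represents h f → Represents h′ f → h′ ≪ h
  self-≪-of-W {h} {h′} h≋f h′≋f = same-sign (realRooted-of-W {h′} h′≋f) (realRooted-of-W {h} h≋f)
    (inj₂ refl , alternate-self (RealRooted.decreasing (realRooted-of-W {h} h≋f)))
    (inj₁ (0<fromℚ lead , 0<fromℚ lead))
    where lead = subst (λ m → 0ℚ ℚ.< co f m) (sym (Zeros.xs-length (proj₂ (zeros-of false λ ())))) 0<f-lead

  ≪-of-W : ∀ same → let e = if same then suc d else d in
           DegreeAtMostℚ e g → 0ℚ ℚ.< co g e →
           ∀ {h h′} → Represents h f → Represents h′ g → h′ ≪ h
  ≪-of-W same g-deg 0<g-lead {h} {h′} h≋f h′≋g = same-sign
    (realRooted g {h′} h′≋g (subst (λ m → DegreeAtMostℚ m g) (sym (Zeros.ys-length z)) g-deg) g-lead (Zeros.ys-desc z) (Zeros.ys-roots z))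
    (f-realRooted {h = h} z h≋f)
    (degrees same (Zeros.xs-length z) (Zeros.ys-length z) , descending⇒linked (Zeros.interlaced z))
    (inj₁ (0<fromℚ g-lead , 0<fromℚ (subst (λ m → 0ℚ ℚ.< co f m) (sym (Zeros.xs-length z)) 0<f-lead)))
    where
    below : ∀ same → (let e = if same then suc d else d in DegreeAtMostℚ e g → 0ℚ ℚ.< co g e → T same → HasSignBelow g (sgn 1ℚ (suc d)))
    below true g-deg 0<g-lead tt = sign-below (suc d) g g-deg 0<g-lead
    z = proj₂ (zeros-of same (below same g-deg 0<g-lead))
    g-lead = subst (λ m → 0ℚ ℚ.< co g m) (sym (Zeros.ys-length z)) 0<g-lead
    degrees : ∀ same {m e} → m ≡ suc d → e ≡ (if same then suc d else d) → m ≡ suc e ⊎ m ≡ e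
    degrees true  refl refl = inj₂ refl
    degrees false refl refl = inj₁ refl

W-self : ∀ u x → W u u x ≡ 0ℚ
W-self u x = solve 2 (λ u u′ → u :* u′ :- u′ :* u := con 0ℚ) refl (ev u x) (dv u x)

-- Coefficients of the reversal

coeff-map-applyUpTo : ∀ (g : ℕ → ℝ) (f : ℕ → ℕ) m {i} → i ℕ.< m → coeff (map g (applyUpTo f m)) i ≡ g (f i)
coeff-map-applyUpTo g f (suc m) {zero}  _         = refl
coeff-map-applyUpTo g f (suc m) {suc i} (s≤s i<m) = coeff-map-applyUpTo g (f ∘ suc) m i<m

coeff-map-applyUpTo-≥ : ∀ (g : ℕ → ℝ) (f : ℕ → ℕ) m {i} → m ℕ.≤ i → coeff (map g (applyUpTo f m)) i ≡ 0ᴿ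
coeff-map-applyUpTo-≥ g f zero            _         = refl
coeff-map-applyUpTo-≥ g f (suc m) {suc i} (s≤s m≤i) = coeff-map-applyUpTo-≥ g (f ∘ suc) m m≤i

coeff-𝓘 : ∀ n p {i} → i ℕ.≤ n → coeff (𝓘 n p) i ≡ coeff p (n ∸ i)
coeff-𝓘 n p i≤n = coeff-map-applyUpTo (λ i → coeff p (n ∸ i)) (λ i → i) (suc n) (s≤s i≤n)

≤ᴿ-pointwise : ∀ {x y a b} → (∀ n → seq x n ≡ a) → (∀ n → seq y n ≡ b) → a ℚ.≤ b → x ≤ y
≤ᴿ-pointwise x≡a y≡b a≤b ε 0<ε = 0 , λ n _ → subst₂ (λ s t → s ℚ.≤ t + ε) (sym (x≡a n)) (sym (y≡b n))
  (ℚP.≤-trans a≤b (≤-from-slack (ℚP.<⇒≤ 0<ε) refl))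

-- In the notation of the theorem n = ν + 1, k = κ + 1 and ρ = k - 1 - n. The words of length n
-- starting after the letter 0 give 𝒜 n k, those starting after ρ give its reversal.
module Proof (κ ν ρ : ℕ) (ρ+n≡κ : ρ ℕ.+ suc ν ≡ κ) (𝓐 : ℝ[X])
             (coeff-𝓐 : ∀ i N → seq (coeff 𝓐 i) N ≡ co (Family.P κ (suc (suc ν)) 0) i) where
  open Family κ
  open Coefficients κ

  private
    n k : ℕ
    n = suc ν
    k = suc κ

    n≤κ : n ℕ.≤ κ
    n≤κ = subst (n ℕ.≤_) ρ+n≡κ (ℕP.m≤n+m n ρ)

    ρ≤κ : ρ ℕ.≤ κ
    ρ≤κ = subst (ρ ℕ.≤_) ρ+n≡κ (ℕP.m≤m+n ρ n)

    0<κ : 0 ℕ.< κ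
    0<κ = ℕP.<-≤-trans (s≤s z≤n) n≤κ

    -- The indices `1 , … , κ` are cut at `ρ`: `b` sums the first `ρ` members and `t` the remaining
    -- `n`.
    p q a b t : ℚ[X]
    p = P (suc n) 0
    q = P (suc n) ρ
    t = sumP (P n) (suc ρ) n
    a = P n 0 ⊕ X⊗ t
    b = sumP (P n) 1 ρ

    co-p : ∀ i → co p i ≡ co (P n 0) i + (co (X⊗ b) i + co (X⊗ t) i)
    co-p i = trans (co-⊕ (P n 0 ⊕ []) _ i) (cong₂ _+_
      (trans (co-⊕ (P n 0) [] i) (ℚP.+-identityʳ (co (P n 0) i)))
      (subst (λ m → co (X⊗ sumP (P n) 1 m) i ≡ co (X⊗ b) i + co (X⊗ t) i) ρ+n≡κ
        (sumP-split (coX-additive i) (P n) 1 ρ n)))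

    co-q : ∀ i → co q i ≡ co (P n 0) i + co b i + co (X⊗ t) i
    co-q i = trans (co-⊕ (P n 0 ⊕ b) _ i) (cong₂ _+_ (co-⊕ (P n 0) b i)
      (cong (λ m → co (X⊗ sumP (P n) (suc ρ) m) i) (trans (cong (_∸ ρ) (sym ρ+n≡κ)) (ℕP.m+n∸m≡n ρ n))))

    co-a : ∀ i → co a i ≡ co (P n 0) i + co (X⊗ t) i
    co-a i = co-⊕ (P n 0) (X⊗ t) i

    p≡a+Xb : ∀ i → co p i ≡ co a i + co (X⊗ b) i
    p≡a+Xb i = trans (co-p i) (trans
      (solve 3 (λ c b t → c :+ (b :+ t) := c :+ t :+ b) refl (co (P n 0) i) (co (X⊗ b) i) (co (X⊗ t) i))
      (cong (_+ co (X⊗ b) i) (sym (co-a i))))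

    q≡a+b : ∀ i → co q i ≡ co a i + co b i
    q≡a+b i = trans (co-q i) (trans
      (solve 3 (λ c b t → c :+ b :+ t := c :+ t :+ b) refl (co (P n 0) i) (co b i) (co (X⊗ t) i))
      (cong (_+ co b i) (sym (co-a i))))

    -- This identity singles out `ρ`: the arguments of `w` for index `i` of `q` and index `n - i` of
    -- `p` add up to `(n + 1) κ`, so they are reflections of each other.
    ρ+nk : ρ ℕ.+ n ℕ.* k ≡ suc n ℕ.* κ
    ρ+nk = trans (cong (ρ ℕ.+_) (ℕP.*-suc n κ))
      (trans (sym (ℕP.+-assoc ρ n (n ℕ.* κ))) (cong (ℕ._+ n ℕ.* κ) ρ+n≡κ))

    reversal : ∀ {i} → i ℕ.≤ n → co q i ≡ co p (n ∸ i)
    reversal {i} i≤n = begin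
      co q i                                        ≡⟨ co-P (suc n) ρ i ρ≤κ ⟩
      w (suc n) (⁺ s)                               ≡⟨ w-symmetric (suc n) (⁺ s) ⟩
      w (suc n) (⁺ (suc n ℕ.* κ) ℤ.- ⁺ s)           ≡⟨ cong (λ D → w (suc n) (⁺ D ℤ.- ⁺ s)) (sym complement) ⟩
      w (suc n) (⁺ ((n ∸ i) ℕ.* k ℕ.+ s) ℤ.- ⁺ s)   ≡⟨ cong (w (suc n)) (ℤR.solve 2 (λ u s → (u ℤR.:+ s) ℤR.:- s ℤR.:= u) refl (⁺ ((n ∸ i) ℕ.* k)) (⁺ s)) ⟩
      w (suc n) (⁺ ((n ∸ i) ℕ.* k))                 ≡⟨ sym (co-P (suc n) 0 (n ∸ i) z≤n) ⟩
      co p (n ∸ i)                                  ∎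
      where
      open ≡-Reasoning
      s = ρ ℕ.+ i ℕ.* k
      complement : (n ∸ i) ℕ.* k ℕ.+ (ρ ℕ.+ i ℕ.* k) ≡ suc n ℕ.* κ
      complement = begin
        (n ∸ i) ℕ.* k ℕ.+ (ρ ℕ.+ i ℕ.* k)
          ≡⟨ ℕR.solve 4 (λ e k ρ i → e ℕR.:* k ℕR.:+ (ρ ℕR.:+ i ℕR.:* k) ℕR.:= ρ ℕR.:+ (e ℕR.:+ i) ℕR.:* k) refl (n ∸ i) k ρ i ⟩
        ρ ℕ.+ (n ∸ i ℕ.+ i) ℕ.* k
          ≡⟨ cong (λ m → ρ ℕ.+ m ℕ.* k) (ℕP.m∸n+n≡m i≤n) ⟩
        ρ ℕ.+ n ℕ.* k
          ≡⟨ ρ+nk ⟩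
        suc n ℕ.* κ ∎

    p-degree : DegreeAtMostℚ n p
    p-degree = P-degree n 0 z≤n

    q-degree : DegreeAtMostℚ n q
    q-degree = P-degree n ρ ρ≤κ

    -- The leading coefficient is the value of `w` at `m (κ + 1) = m κ + m`, which is at most
    -- `(m + 1) κ` because `m ≤ κ`. This is where `k > n` enters.
    P-lead : ∀ m → m ℕ.≤ κ → 1ℚ ℚ.≤ co (P (suc m) 0) m
    P-lead m m≤κ = subst (1ℚ ℚ.≤_) (sym (co-P (suc m) 0 m z≤n)) (w≥1 (suc m)
      (subst (ℕ._≤ suc m ℕ.* κ) (sym (ℕP.*-suc m κ)) (ℕP.+-monoˡ-≤ (m ℕ.* κ) m≤κ)))

    P-0 : ∀ m → 1ℚ ℚ.≤ co (P m 0) 0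
    P-0 m = subst (1ℚ ℚ.≤_) (sym (co-P m 0 0 z≤n)) (w≥1 m z≤n)

    q-lead : 1ℚ ℚ.≤ co q n
    q-lead = subst (1ℚ ℚ.≤_) (sym (co-P (suc n) ρ n ρ≤κ)) (w≥1 (suc n) (ℕP.≤-reflexive ρ+nk))

    b-degree : ∀ i → ν ℕ.< i → co b i ≡ 0ℚ
    b-degree i ν<i = trans
      (sumP-cong (co-additive i) (co-additive i) (P n) (λ _ → []) 1 ρ
        (λ l _ l≤ρ → P-degree ν l (ℕP.≤-trans (ℕ.s≤s⁻¹ l≤ρ) ρ≤κ) i ν<i))
      (sumP-zero (co-additive i) (λ _ → []) 1 ρ (λ _ _ → refl))

    -- Read off from `a + b = q`, where `b` contributes nothing from index `n` on; the same argument
    -- gives `a-lead`.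
    a-degree : DegreeAtMostℚ n a
    a-degree i n<i = begin
      co a i                ≡⟨ sym (trans (cong (λ v → co a i + v) (b-degree i (ℕP.<⇒≤ n<i))) (ℚP.+-identityʳ (co a i))) ⟩
      co a i + co b i       ≡⟨ sym (q≡a+b i) ⟩
      co q i                ≡⟨ q-degree i n<i ⟩
      0ℚ                    ∎
      where open ≡-Reasoning

    a-lead : 1ℚ ℚ.≤ co a n
    a-lead = subst (1ℚ ℚ.≤_) (trans (q≡a+b n) (trans (cong (co a n +_) (b-degree n ℕP.≤-refl)) (ℚP.+-identityʳ _))) q-lead

    a-0 : 1ℚ ℚ.≤ co a 0
    a-0 = subst (1ℚ ℚ.≤_) (sym (trans (co-a 0) (ℚP.+-identityʳ _))) (P-0 n)

    b-lead : 0 ℕ.< ρ → 1ℚ ℚ.≤ co b ν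
    b-lead 0<ρ = subst (λ m → 1ℚ ℚ.≤ co (sumP (P n) 1 m) ν) (ℕP.suc-pred ρ {{ℕ.>-nonZero 0<ρ}})
      (sumP-≥1 (co-additive ν) (P n) 1 (ℕ.pred ρ) λ l _ l< →
        let l≤ρ : l ℕ.≤ ρ
            l≤ρ = subst (l ℕ.≤_) (ℕP.suc-pred ρ {{ℕ.>-nonZero 0<ρ}}) (ℕ.s≤s⁻¹ l<)
        in subst (1ℚ ℚ.≤_) (sym (co-P n l ν (ℕP.≤-trans l≤ρ ρ≤κ))) (w≥1 n (begin
          l ℕ.+ ν ℕ.* k            ≤⟨ ℕP.+-monoˡ-≤ (ν ℕ.* k) l≤ρ ⟩
          ρ ℕ.+ ν ℕ.* k            ≡⟨ cong (ρ ℕ.+_) (ℕP.*-suc ν κ) ⟩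
          ρ ℕ.+ (ν ℕ.+ ν ℕ.* κ)    ≡⟨ sym (ℕP.+-assoc ρ ν _) ⟩
          ρ ℕ.+ ν ℕ.+ ν ℕ.* κ      ≤⟨ ℕP.+-monoˡ-≤ (ν ℕ.* κ) (subst (ρ ℕ.+ ν ℕ.≤_) ρ+n≡κ (ℕP.+-monoʳ-≤ ρ (ℕP.n≤1+n ν))) ⟩
          n ℕ.* κ                  ∎)))
      where open ℕP.≤-Reasoning

    W-next : ∀ m c d → (∀ {l} → c ℕ.≤ l → l ℕ.< c ℕ.+ suc d → 0 ℕ.< l × l ℕ.≤ κ) → ∀ x →
             1ℚ ℚ.≤ W (P (suc m) 0) (X⊗ sumP (P (suc m)) c (suc d)) x
    W-next m c d range x = sumP-≥1 (WX-additiveʳ (P (suc m) 0) x) (P (suc m)) c d λ l c≤l l< →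
      let 0<l , l≤κ = range c≤l l< in proj₂ (interlacing m 0<l l≤κ x)

    W-⊕X : ∀ u v x → W u (u ⊕ v) x ≡ W u v x
    W-⊕X u v x = trans (⊕-homo (W-additiveʳ u x) u v)
      (trans (cong (_+ W u v x) (W-self u x)) (ℚP.+-identityˡ _))

    -- The next member 0 is `u + v` with `v` the shifted sum over `l ≥ 1`, and `W u u` vanishes.
    W-P : ∀ m x → 1ℚ ℚ.≤ W (P (suc m) 0) (P (suc (suc m)) 0) x
    W-P m x = subst (1ℚ ℚ.≤_) (sym W≡)
      (subst (λ d → 1ℚ ℚ.≤ W u (X⊗ sumP (P (suc m)) 1 d) x) (ℕP.suc-pred κ {{κ≢0}})
        (W-next m 1 (ℕ.pred κ) (λ 0<l l< → 0<l , subst (_ ℕ.≤_) (ℕP.suc-pred κ {{κ≢0}}) (ℕ.s≤s⁻¹ l<)) x))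
      where
      κ≢0 = ℕ.>-nonZero 0<κ
      u v : ℚ[X]
      u = P (suc m) 0
      v = X⊗ sumP (P (suc m)) 1 κ
      W≡ : W u ((u ⊕ []) ⊕ v) x ≡ W u v x
      W≡ = trans (⊕-homo (W-additiveʳ u x) (u ⊕ []) v)
        (trans (cong (_+ W u v x) (trans (W-⊕X u [] x) (zero-homo (W-additiveʳ u x)))) (ℚP.+-identityˡ (W u v x)))

    t-range : ∀ {l} → suc ρ ℕ.≤ l → l ℕ.< suc ρ ℕ.+ n → 0 ℕ.< l × l ℕ.≤ κ
    t-range ρ<l l< = ℕP.≤-trans (s≤s z≤n) ρ<l , subst (_ ℕ.≤_) ρ+n≡κ (ℕ.s≤s⁻¹ l<)

    W-Pa : ∀ x → 1ℚ ℚ.≤ W (P n 0) a x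
    W-Pa x = subst (1ℚ ℚ.≤_) (sym (W-⊕X (P n 0) (X⊗ t) x)) (W-next ν (suc ρ) ν t-range x)

    -- All indices in `b` are positive and at most `ρ`, those in `t` exceed `ρ`: so
    -- `W b (P n 0) ≥ 0` and `W b (X⊗ t) ≥ 1`, where `0 < ρ` makes `b` a nonempty sum.
    W-ba : 0 ℕ.< ρ → ∀ x → 1ℚ ℚ.≤ W b a x
    W-ba 0<ρ x = subst (1ℚ ℚ.≤_) (sym (⊕-homo (W-additiveʳ b x) (P n 0) (X⊗ t)))
      (ℚP.+-mono-≤ {0ℚ} {W b (P n 0) x} {1ℚ} {W b (X⊗ t) x}
        (sumP-nonneg (W-additiveˡ (P n 0) x) (P n) 1 ρ λ l 0<l l≤ρ →
          proj₁ (interlacing ν 0<l (ℕP.≤-trans (ℕ.s≤s⁻¹ l≤ρ) ρ≤κ) x))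
        (subst (λ m → 1ℚ ℚ.≤ W (sumP (P n) 1 m) (X⊗ t) x) (ℕP.suc-pred ρ {{ℕ.>-nonZero 0<ρ}})
          (sumP-≥1 (W-additiveˡ (X⊗ t) x) (P n) 1 (ℕ.pred ρ) λ l 0<l l< →
            sumP-≥1 (WX-additiveʳ (P n l) x) (P n) (suc ρ) ν λ l′ ρ<l′ l′< →
              proj₂ (interlacing ν
                (ℕP.≤-<-trans (subst (l ℕ.≤_) (ℕP.suc-pred ρ {{ℕ.>-nonZero 0<ρ}}) (ℕ.s≤s⁻¹ l<)) ρ<l′)
                (proj₂ (t-range ρ<l′ l′<)) x))))

    0<-of-≥1 : ∀ {v} → 1ℚ ℚ.≤ v → 0ℚ ℚ.< v
    0<-of-≥1 = ℚP.<-≤-trans 0<1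

    P-alternates : ∀ m → m ℕ.≤ κ → Alternates (P (suc m) 0) 1ℚ 0ℚ m
    P-alternates zero    _     = last (subst (0ℚ ℚ.<_) (sym (trans (ℚP.*-identityˡ _) (ev-0 (P 1 0)))) (0<-of-≥1 (P-0 1)))
    P-alternates (suc m) m<κ = alternates-next {P (suc m) 0} {P (suc (suc m)) 0} (W-P m) (P-alternates m (ℕP.<⇒≤ m<κ))
      (0<-of-≥1 (P-0 (suc (suc m)))) (P-degree (suc m) 0 z≤n) (0<-of-≥1 (P-lead (suc m) m<κ))

    a-alternates : Alternates a 1ℚ 0ℚ n
    a-alternates = alternates-next {P n 0} {a} W-Pa (P-alternates ν (ℕP.<⇒≤ n≤κ)) (0<-of-≥1 a-0) a-degree (0<-of-≥1 a-lead)

    𝓐≋p : Represents 𝓐 p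
    𝓐≋p i = ≋-pointwise (coeff-𝓐 i)

    𝓘𝓐≋q : Represents (𝓘 n 𝓐) q
    𝓘𝓐≋q i with i ℕP.≤? n
    ... | yes i≤n = ≋-pointwise λ N → trans (cong (λ c → seq c N) (coeff-𝓘 n 𝓐 i≤n))
                      (trans (coeff-𝓐 (n ∸ i) N) (sym (reversal i≤n)))
    ... | no  i≰n = ≋-pointwise λ N → trans
                      (cong (λ c → seq c N) (coeff-map-applyUpTo-≥ (λ j → coeff 𝓐 (n ∸ j)) (λ j → j) (suc n) (ℕP.≰⇒> i≰n)))
                      (sym (q-degree i (ℕP.≰⇒> i≰n)))

  hasDegree : HasDegree n 𝓐
  hasDegree = inj₂ (1ℚ , 0<1 , 0 , λ N _ → subst (1ℚ ℚ.≤_) (sym (coeff-𝓐 n N)) (P-lead n n≤κ))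
            , λ i n<i → closeness (≋-pointwise λ N → trans (coeff-𝓐 i N) (p-degree i n<i))

  reversal-≪ : 𝓘 n 𝓐 ≪ 𝓐
  reversal-≪ with 0 ℕP.<? ρ
  ... | yes 0<ρ = ≪-of-W {p} {q} (λ x → W-suc≥1 n (interlacing ν) 0<ρ ρ≤κ x) (P-alternates n n≤κ)
                    p-degree (0<-of-≥1 (P-lead n n≤κ)) true q-degree (0<-of-≥1 q-lead) {𝓐} {𝓘 n 𝓐} 𝓐≋p 𝓘𝓐≋q
  -- For `ρ = 0` the reversal is `p` itself, and `W p p` vanishes; member `κ` takes over as the
  -- partner that isolates the zeros.
  ... | no  0≮ρ = self-≪-of-W {p} {P (suc n) κ} (λ x → W-suc≥1 n (interlacing ν) 0<κ ℕP.≤-refl x) (P-alternates n n≤κ)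
                    p-degree (0<-of-≥1 (P-lead n n≤κ)) {𝓐} {𝓘 n 𝓐} 𝓐≋p
                    (subst (λ j → Represents (𝓘 n 𝓐) (P (suc n) j)) (ℕP.n≤0⇒n≡0 (ℕP.≮⇒≥ 0≮ρ)) 𝓘𝓐≋q)

  alternatinglyIncreasing : AlternatinglyIncreasing n 𝓐
  alternatinglyIncreasing = record
    { has-degree = hasDegree
    ; 0≤p₀       = ≤ᴿ-pointwise {0ᴿ} {coeff 𝓐 0} (λ _ → refl) (coeff-𝓐 0) (ℚP.≤-trans 0≤1 (P-0 (suc n)))
    ; pᵢ≤pₙ₋ᵢ    = λ i 2i≤n → ≤ᴿ-pointwise {coeff 𝓐 i} {coeff 𝓐 (n ∸ i)} (coeff-𝓐 i) (coeff-𝓐 (n ∸ i))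
        (subst₂ ℚ._≤_ (sym (co-P (suc n) 0 i z≤n)) (sym (co-P (suc n) 0 (n ∸ i) z≤n))
          (w-mono (suc n) (ℕP.*-monoˡ-≤ k (ℕP.m+n≤o⇒m≤o∸n i 2i≤n)) (begin
            i ℕ.* k ℕ.+ (n ∸ i) ℕ.* k   ≡⟨ sym (ℕP.*-distribʳ-+ k i (n ∸ i)) ⟩
            (i ℕ.+ (n ∸ i)) ℕ.* k       ≡⟨ cong (ℕ._* k) (ℕP.m+[n∸m]≡n (ℕP.m+n≤o⇒m≤o i 2i≤n)) ⟩
            n ℕ.* k                     ≤⟨ ℕP.m≤n+m (n ℕ.* k) ρ ⟩
            ρ ℕ.+ n ℕ.* k               ≡⟨ ρ+nk ⟩
            suc n ℕ.* κ                 ∎)))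
    -- The coefficient at `n - i` is first reflected to the argument `ρ + i k`, which is smaller
    -- than `(i + 1) k`.
    ; pₙ₋ᵢ≤pᵢ₊₁  = λ i 2i<n → ≤ᴿ-pointwise {coeff 𝓐 (n ∸ i)} {coeff 𝓐 (suc i)}
        (λ N → trans (coeff-𝓐 (n ∸ i) N) (sym (reversal (ℕP.m+n≤o⇒m≤o i (ℕP.<⇒≤ 2i<n))))) (coeff-𝓐 (suc i))
        (subst₂ ℚ._≤_ (sym (co-P (suc n) ρ i ρ≤κ)) (sym (co-P (suc n) 0 (suc i) z≤n))
          (w-mono (suc n) (ℕP.+-monoˡ-≤ (i ℕ.* k) (ℕP.m≤n⇒m≤1+n ρ≤κ)) (begin
            ρ ℕ.+ i ℕ.* k ℕ.+ suc i ℕ.* k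
              ≡⟨ ℕR.solve 3 (λ ρ i k → ρ ℕR.:+ i ℕR.:* k ℕR.:+ (ℕR.con 1 ℕR.:+ i) ℕR.:* k
                   ℕR.:= ρ ℕR.:+ (ℕR.con 1 ℕR.:+ (i ℕR.:+ i)) ℕR.:* k) refl ρ i k ⟩
            ρ ℕ.+ suc (i ℕ.+ i) ℕ.* k   ≤⟨ ℕP.+-monoʳ-≤ ρ (ℕP.*-monoˡ-≤ k 2i<n) ⟩
            ρ ℕ.+ n ℕ.* k               ≡⟨ ρ+nk ⟩
            suc n ℕ.* κ                 ∎)))
    }
    where open ℕP.≤-Reasoning

  module _ (a′ b′ : ℝ[X]) (dec : 𝓘-Decomposition n 𝓐 a′ b′) where
    open 𝓘-Decomposition dec

    private
      A B XB : ℕ → ℕ → ℚ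
      A i = seq (coeff a′ i)
      B i = seq (coeff b′ i)
      XB zero    = λ _ → 0ℚ
      XB (suc i) = B i

      A+XB : ∀ i → (λ N → A i N + XB i N) ≋ (λ _ → co p i)
      A+XB i = ≋-sym (≋-trans (≋-sym (𝓐≋p i)) (≋-trans (close (sum i))
        (≋-pointwise λ N → trans (coeff-+ᴾ a′ (X *ᴾ b′) i N) (cong (A i N +_) (shift i N)))))
        where
        shift : ∀ i N → seq (coeff (X *ᴾ b′) i) N ≡ XB i N
        shift zero    N = trans (coeff-linear-0 0ᴿ b′ N) (ℚP.*-zeroˡ (B 0 N))
        shift (suc i) N = trans (coeff-linear-suc 0ᴿ b′ N i)
          (trans (cong (_+ B i N) (ℚP.*-zeroˡ (B (suc i) N))) (ℚP.+-identityˡ (B i N)))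

      A-symmetric : ∀ {i} → i ℕ.≤ n → A (n ∸ i) ≋ A i
      A-symmetric {i} i≤n = subst (λ c → seq c ≋ A i) (coeff-𝓘 n a′ i≤n) (close (symmetric-a i))

      B-symmetric : ∀ {i} → i ℕ.≤ ν → B (ν ∸ i) ≋ B i
      B-symmetric {i} i≤ν = subst (λ c → seq c ≋ B i) (coeff-𝓘 ν b′ i≤ν) (close (symmetric-b i))

      -- Reading `p = a′ + x b′` at index `n - i` and applying both symmetries yields the reversed
      -- coefficient.
      A+B : ∀ {i} → i ℕ.≤ ν → (λ N → A i N + B i N) ≋ (λ _ → co q i)
      A+B {i} i≤ν = ≋-trans (≋-sym (≋-+ (A-symmetric i≤n) (B-symmetric i≤ν)))
        (subst₂ (λ m v → (λ N → A m N + B (ν ∸ i) N) ≋ (λ _ → v)) (sym n∸i) (trans (cong (co p) (sym n∸i)) (sym (reversal i≤n)))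
          (A+XB (suc (ν ∸ i))))
        where
        i≤n = ℕP.m≤n⇒m≤1+n i≤ν
        n∸i : n ∸ i ≡ suc (ν ∸ i)
        n∸i = ℕP.+-∸-assoc 1 i≤ν

      minus-one = fromℚ (- 1ℚ)

      -- Uniqueness of the decomposition: the difference of `a′ + b′ = q` and `a′ + x b′ = p`
      -- expresses each coefficient of `b′` through the preceding one, and `b` obeys the same
      -- recursion.
      B≋b-step : ∀ {i} → i ℕ.≤ ν → XB i ≋ (λ _ → co (X⊗ b) i) → B i ≋ (λ _ → co b i)
      B≋b-step {i} i≤ν prev = ≋-trans
        (≋-pointwise λ N → solve 3 (λ a b c → b := (a :+ b) :+ ((:- con 1ℚ) :* (a :+ c) :+ c)) refl (A i N) (B i N) (XB i N))
        (≋-trans (≋-+ (A+B i≤ν) (≋-+ (≋-* minus-one (A+XB i)) prev))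
          (≋-pointwise λ _ → trans
            (cong₂ (λ u v → u + ((- 1ℚ) * v + co (X⊗ b) i)) (q≡a+b i) (p≡a+Xb i))
            (solve 3 (λ a b c → (a :+ b) :+ ((:- con 1ℚ) :* (a :+ c) :+ c) := b) refl (co a i) (co b i) (co (X⊗ b) i))))

      B≋b : ∀ {i} → i ℕ.≤ ν → B i ≋ (λ _ → co b i)
      B≋b {zero}  i≤ν = B≋b-step i≤ν (≋-pointwise λ _ → refl)
      B≋b {suc i} i≤ν = B≋b-step i≤ν (B≋b (ℕP.<⇒≤ i≤ν))

      b′≋b : Represents b′ b
      b′≋b i with i ℕP.≤? ν
      ... | yes i≤ν = B≋b i≤ν
      ... | no  i≰ν = ≋-trans (close (degree-b i (ℕP.≰⇒> i≰ν))) (≋-pointwise λ _ → sym (b-degree i (ℕP.≰⇒> i≰ν)))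

      XB≋Xb : ∀ i → XB i ≋ (λ _ → co (X⊗ b) i)
      XB≋Xb zero    = ≋-pointwise λ _ → refl
      XB≋Xb (suc i) = b′≋b i

      a′≋a : Represents a′ a
      a′≋a i = ≋-trans
        (≋-pointwise λ N → solve 2 (λ a c → a := (a :+ c) :+ (:- con 1ℚ) :* c) refl (A i N) (XB i N))
        (≋-trans (≋-+ (A+XB i) (≋-* minus-one (XB≋Xb i)))
          (≋-pointwise λ _ → trans (cong (_+ (- 1ℚ) * co (X⊗ b) i) (p≡a+Xb i))
            (solve 2 (λ a c → (a :+ c) :+ (:- con 1ℚ) :* c := a) refl (co a i) (co (X⊗ b) i))))

    decomposition-≪ : b′ ≪ a′
    decomposition-≪ with 0 ℕP.<? ρ
    ... | yes 0<ρ = ≪-of-W {a} {b} (W-ba 0<ρ) a-alternates a-degree (0<-of-≥1 a-lead) false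
                      b-degree (0<-of-≥1 (b-lead 0<ρ)) {a′} {b′} a′≋a b′≋b
    -- For `ρ = 0` the sum `b` is empty and `a` coincides with `p`, so the convention for the zero
    -- polynomial applies.
    ... | no  0≮ρ = zeroˡ (λ i → closeness (≋-trans (b′≋b i) (≋-pointwise λ _ → b≡0 i)))
                      (realRooted-of-W {p} {P (suc n) κ} (λ x → W-suc≥1 n (interlacing ν) 0<κ ℕP.≤-refl x)
                        (P-alternates n n≤κ) p-degree (0<-of-≥1 (P-lead n n≤κ)) {a′}
                        (λ i → ≋-trans (a′≋a i) (≋-pointwise λ _ → a≡p i)))
      where
      b≡0 : ∀ i → co b i ≡ 0ℚ
      b≡0 i = cong (λ m → co (sumP (P n) 1 m) i) (ℕP.n≤0⇒n≡0 (ℕP.≮⇒≥ 0≮ρ))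
      Xb≡0 : ∀ i → co (X⊗ b) i ≡ 0ℚ
      Xb≡0 zero    = refl
      Xb≡0 (suc i) = b≡0 i
      a≡p : ∀ i → co a i ≡ co p i
      a≡p i = sym (trans (p≡a+Xb i) (trans (cong (co a i +_) (Xb≡0 i)) (ℚP.+-identityʳ _)))

proposition5p5 : ∀ (n k : ℕ) → .{{_ : NonZero n}} → .{{_ : NonZero k}} → n ℕ.< k →
    (HasDegree n (𝒜 n k) × 𝓘 n (𝒜 n k) ≪ 𝒜 n k)
    × AlternatinglyIncreasing n (𝒜 n k)
    × (∀ (a b : ℝ[X]) → 𝓘-Decomposition n (𝒜 n k) a b → b ≪ a)
proposition5p5 zero    k       {{n≢0}} n<k       = contradiction refl (ℕ.≢-nonZero⁻¹ 0 {{n≢0}})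
proposition5p5 (suc ν) (suc κ) (s≤s n≤κ) =
  (hasDegree , reversal-≪) , alternatinglyIncreasing , decomposition-≪
  where open Proof κ ν (κ ∸ suc ν) (ℕP.m∸n+n≡m n≤κ) (𝒜 (suc ν) (suc κ)) (Ascents.coeff-𝒜 κ (suc ν))
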